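{- Let $m,n$ be positive integers and let $(A,\boldsymbol{\gamma})\in\left([0,1)^{m\times n}\times[0,1)^m\right)\setminus\mathbf{Bad}(m,n)$. Then, in the metric space $(\mathcal{C},d)$: (i) $\mathcal{C}(A,\boldsymbol{\gamma})$ is a $G_\delta$ set and is dense in $\mathcal{C}$; (ii) $\mathcal{C}(A,\boldsymbol{\gamma})$ is not an $F_\sigma$ set in $\mathcal{C}$.
   Context: $[0,1)^{m\times n}$ is the set of real $m\times n$ matrices with entries in $[0,1)$. For $\boldsymbol{x}\in\mathbb{R}^n$, $\|\boldsymbol{x}\|=\max_i|x_i|$; for $\boldsymbol{y}\in\mathbb{R}^m$, $\langle\boldsymbol{y}\rangle=\min_{\boldsymbol{p}\in\mathbb{Z}^m}\|\boldsymbol{y}-\boldsymbol{p}\|$. "Decreasing" means non-increasing. $\mathcal{C}$ is the set of decreasing $\psi:\mathbb{N}\to[0,\infty)$ with $\sum_{q\ge1}q^{n-1}\psi(q)^m<\infty$, equipped with the metric $d(\psi_1,\psi_2)=\sum_{q\ge1}q^{n-1}|\psi_1(q)^m-\psi_2(q)^m|$. $\mathcal{C}(A,\boldsymbol{\gamma})=\{\psi\in\mathcal{C}:\langle A\boldsymbol{q}-\boldsymbol{\gamma}\rangle<\psi(\|\boldsymbol{q}\|)\text{ for infinitely many }\boldsymbol{q}\in\mathbb{Z}^n\}$. $\mathbf{Bad}(m,n)=\{(A,\boldsymbol{\gamma}):\liminf_{\boldsymbol{q}\in\mathbb{Z}^n,\|\boldsymbol{q}\|\to\infty}\|\boldsymbol{q}\|^n\langle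 A\boldsymbol{q}-\boldsymbol{\gamma}\rangle^m>0\}$. -}

module Defs where

open import Algebra.Bundles using (CommutativeRing; Semiring)
import Algebra.Construct.NaturalChoice.Max as Max
import Algebra.Definitions.RawSemiring as RawSemiringDefs
import Algebra.Properties.Ring as RingProperties
open import Axiom.ExcludedMiddle using (ExcludedMiddle)
open import Data.Empty using (⊥-elim)
open import Data.Integer as ℤ using (ℤ; +_; -[1+_])
import Data.Integer.Properties as ℤₚ
open import Data.List using (List)
open import Data.List.Membership.Propositional using (_∈_)
open import Data.Nat as ℕ using (ℕ; zero; suc; NonZero; z≤n; s≤s; _∸_)
import Data.Nat.Properties as ℕₚ
open import Data.Product using (Σ; ∃; _×_; _,_; proj₁; proj₂)
open import Data.Sum using (inj₁; inj₂)
open import Data.Vec as Vec using (Vec; []; _∷_)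
open import Data.Vec.Relation.Unary.All using (All)
open import Function using (flip)
open import Level using (0ℓ)
open import Relation.Binary using (Rel; IsTotalOrder; TotalOrder)
import Relation.Binary.Construct.Add.Extrema.NonStrict as AddExtremaNonStrict
import Relation.Binary.Construct.Add.Extrema.Strict as AddExtremaStrict
import Relation.Binary.Construct.Add.Supremum.NonStrict as ≤⁺
import Relation.Binary.Construct.NonStrictToStrict as NonStrictToStrict
import Relation.Binary.Reasoning.PartialOrder as PosetReasoning
open import Relation.Binary.PropositionalEquality as ≡ using (_≡_)
open import Relation.Nullary using (¬_; Dec; yes; no)
open import Relation.Nullary.Construct.Add.Extrema using (_±; ⊥±; ⊤±; [_])
open import Relation.Unary using (Pred; _≐_; ∁; ⋃; ⋂; _⊆_)

UpperBound : ∀ {A : Set} → Rel A 0ℓ → Pred A 0ℓ → Pred A 0ℓ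
UpperBound _≤_ S u = ∀ x → S x → x ≤ u

IsSupremum : ∀ {A : Set} → Rel A 0ℓ → Pred A 0ℓ → Pred A 0ℓ
IsSupremum _≤_ S s = UpperBound _≤_ S s × (∀ u → UpperBound _≤_ S u → s ≤ u)

IsInfimum : ∀ {A : Set} → Rel A 0ℓ → Pred A 0ℓ → Pred A 0ℓ
IsInfimum _≤_ = IsSupremum (flip _≤_)

Infinite : ∀ {A : Set} → Pred A 0ℓ → Set
Infinite {A} P = ¬ (∃ λ (xs : List A) → P ⊆ (_∈ xs))

-- Dedekind-complete ordered fields.  Classically there is exactly one up to
-- isomorphism, namely ℝ, so a statement about ℝ is rendered as a statement
-- about an arbitrary such structure.

record CompleteOrderedField : Set₁ where
  infix 4 _≤_
  field
    commutativeRing : CommutativeRing 0ℓ 0ℓ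

  open CommutativeRing commutativeRing public

  field
    _≤_          : Rel Carrier 0ℓ
    isTotalOrder : IsTotalOrder _≈_ _≤_
    1≉0          : ¬ (1# ≈ 0#)
    inverse      : ∀ x → ¬ (x ≈ 0#) → ∃ λ y → x * y ≈ 1#
    +-monoˡ-≤    : ∀ z {x y} → x ≤ y → x + z ≤ y + z
    *-nonneg     : ∀ {x y} → 0# ≤ x → 0# ≤ y → 0# ≤ x * y
    completeness : (S : Pred Carrier 0ℓ) → ∃ S → ∃ (UpperBound _≤_ S) →
                   ∃ (IsSupremum _≤_ S)

  totalOrder : TotalOrder 0ℓ 0ℓ 0ℓ
  totalOrder = record { isTotalOrder = isTotalOrder }

-- The mathematics is classical.  As ∃ is Σ, excluded middle for Set is the only
-- classical principle needed: choice then comes for free.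

module Real (em : ExcludedMiddle 0ℓ) (ℝ-field : CompleteOrderedField) where

  open CompleteOrderedField ℝ-field public
    renaming (Carrier to ℝ; zero to *-zero)
  open TotalOrder totalOrder public
    using (poset; antisym; total)
    renaming (refl to ≤-refl; trans to ≤-trans; reflexive to ≤-reflexive)
  open NonStrictToStrict _≈_ _≤_ public using (_<_)
  open Max totalOrder public
    using (_⊔_; x≤x⊔y; x≤y⊔x; ⊔-lub; ⊔-mono-≤)
  open RawSemiringDefs (Semiring.rawSemiring semiring) public
    using (_^_) renaming (_×_ to _·_)
  private module ≤± = AddExtremaNonStrict _≤_
  open ≤± public using (_≤±_)
  open AddExtremaStrict _<_ public using (_<±_)

  ∣_∣ : ℝ → ℝ
  ∣ x ∣ = x ⊔ (- x)

  fromℕ : ℕ → ℝ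
  fromℕ k = k · 1#

  fromℤ : ℤ → ℝ
  fromℤ (+ k)    = fromℕ k
  fromℤ -[1+ k ] = - fromℕ (suc k)

  module Lemmas where

    open RingProperties ring
    open PosetReasoning poset

    ≰⇒≥ : ∀ {x y} → ¬ (x ≤ y) → y ≤ x
    ≰⇒≥ {x} {y} ¬p with total x y
    ... | inj₁ p = ⊥-elim (¬p p)
    ... | inj₂ p = p

    ≰⇒< : ∀ {x y} → ¬ (x ≤ y) → y < x
    ≰⇒< ¬p = ≰⇒≥ ¬p , λ e → ¬p (≤-reflexive (sym e))

    <⇒≱ : ∀ {x y} → x < y → ¬ (y ≤ x)
    <⇒≱ (p , ne) q = ne (antisym p q)

    +-monoʳ-≤ : ∀ z {x y} → x ≤ y → z + x ≤ z + y
    +-monoʳ-≤ z {x} {y} p = begin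
      z + x ≈⟨ +-comm z x ⟩
      x + z ≤⟨ +-monoˡ-≤ z p ⟩
      y + z ≈⟨ +-comm y z ⟩
      z + y ∎

    +-mono-≤ : ∀ {x y u v} → x ≤ y → u ≤ v → x + u ≤ y + v
    +-mono-≤ p q = ≤-trans (+-monoˡ-≤ _ p) (+-monoʳ-≤ _ q)

    x-y+y≈x : ∀ x y → (x - y) + y ≈ x
    x-y+y≈x x y = trans (+-assoc x (- y) y)
      (trans (+-congˡ (-‿inverseˡ y)) (+-identityʳ x))

    x+y-y≈x : ∀ x y → (x + y) - y ≈ x
    x+y-y≈x x y = trans (+-assoc x y (- y))
      (trans (+-congˡ (-‿inverseʳ y)) (+-identityʳ x))

    x≤y+z⇒x-z≤y : ∀ {x y z} → x ≤ y + z → x - z ≤ y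
    x≤y+z⇒x-z≤y {x} {y} {z} p = begin
      x - z       ≤⟨ +-monoˡ-≤ (- z) p ⟩
      (y + z) - z ≈⟨ x+y-y≈x y z ⟩
      y           ∎

    x-z≤y⇒x≤y+z : ∀ {x y z} → x - z ≤ y → x ≤ y + z
    x-z≤y⇒x≤y+z {x} {y} {z} p = begin
      x           ≈⟨ x-y+y≈x x z ⟨
      (x - z) + z ≤⟨ +-monoˡ-≤ z p ⟩
      y + z       ∎

    x+z≤y⇒x≤y-z : ∀ {x y z} → x + z ≤ y → x ≤ y - z
    x+z≤y⇒x≤y-z {x} {y} {z} p = begin
      x           ≈⟨ x+y-y≈x x z ⟨
      (x + z) - z ≤⟨ +-monoˡ-≤ (- z) p ⟩
      y - z       ∎

    x≤y-z⇒x+z≤y : ∀ {x y z} → x ≤ y - z → x + z ≤ y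
    x≤y-z⇒x+z≤y {x} {y} {z} p = begin
      x + z       ≤⟨ +-monoˡ-≤ z p ⟩
      (y - z) + z ≈⟨ x-y+y≈x y z ⟩
      y           ∎

    -‿anti-≤ : ∀ {x y} → x ≤ y → - y ≤ - x
    -‿anti-≤ {x} {y} p = begin
      - y           ≈⟨ +-identityˡ (- y) ⟨
      0# - y        ≤⟨ x≤y+z⇒x-z≤y (begin
        0#          ≈⟨ -‿inverseˡ x ⟨
        - x + x     ≤⟨ +-monoʳ-≤ (- x) p ⟩
        - x + y     ∎) ⟩
      - x           ∎

    neg-minus : ∀ x y → - (x - y) ≈ y - x
    neg-minus x y = trans (sym (-‿+-comm x (- y)))
      (trans (+-comm (- x) (- - y)) (+-congʳ (-‿involutive y)))

    0≤1 : 0# ≤ 1#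
    0≤1 with total 0# 1#
    ... | inj₁ p = p
    ... | inj₂ p = begin
      0#            ≤⟨ *-nonneg q q ⟩
      - 1# * - 1#   ≈⟨ -‿distribˡ-* 1# (- 1#) ⟨
      - (1# * - 1#) ≈⟨ -‿cong (*-identityˡ (- 1#)) ⟩
      - - 1#        ≈⟨ -‿involutive 1# ⟩
      1#            ∎
      where
      q : 0# ≤ - 1#
      q = begin
        0#   ≈⟨ -0#≈0# ⟨
        - 0# ≤⟨ -‿anti-≤ p ⟩
        - 1# ∎

    1≰0 : ¬ (1# ≤ 0#)
    1≰0 p = 1≉0 (antisym p 0≤1)

    x≤∣x∣ : ∀ x → x ≤ ∣ x ∣
    x≤∣x∣ x = x≤x⊔y x (- x)

    -x≤∣x∣ : ∀ x → - x ≤ ∣ x ∣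
    -x≤∣x∣ x = x≤y⊔x x (- x)

    0≤∣x∣ : ∀ x → 0# ≤ ∣ x ∣
    0≤∣x∣ x with total 0# x
    ... | inj₁ p = ≤-trans p (x≤∣x∣ x)
    ... | inj₂ p = begin
      0#    ≈⟨ -0#≈0# ⟨
      - 0#  ≤⟨ -‿anti-≤ p ⟩
      - x   ≤⟨ -x≤∣x∣ x ⟩
      ∣ x ∣ ∎

    ∣x-y∣≤x+y : ∀ {x y} → 0# ≤ x → 0# ≤ y → ∣ x - y ∣ ≤ x + y
    ∣x-y∣≤x+y {x} {y} p q = ⊔-lub
      (+-monoʳ-≤ x (begin
        - y  ≤⟨ -‿anti-≤ q ⟩
        - 0# ≈⟨ -0#≈0# ⟩
        0#   ≤⟨ q ⟩
        y    ∎))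
      (begin
        - (x - y) ≈⟨ neg-minus x y ⟩
        y - x     ≤⟨ +-monoʳ-≤ y (begin
          - x  ≤⟨ -‿anti-≤ p ⟩
          - 0# ≈⟨ -0#≈0# ⟩
          0#   ≤⟨ p ⟩
          x    ∎) ⟩
        y + x     ≈⟨ +-comm y x ⟩
        x + y     ∎)

    ^-nonneg : ∀ {x} k → 0# ≤ x → 0# ≤ x ^ k
    ^-nonneg zero    p = 0≤1
    ^-nonneg (suc k) p = *-nonneg p (^-nonneg k p)

    fromℕ-nonneg : ∀ k → 0# ≤ fromℕ k
    fromℕ-nonneg zero    = ≤-refl
    fromℕ-nonneg (suc k) = begin
      0#           ≈⟨ +-identityˡ 0# ⟨
      0# + 0#      ≤⟨ +-mono-≤ 0≤1 (fromℕ-nonneg k) ⟩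
      1# + fromℕ k ∎

    fromℕ-mono : ∀ {j k} → j ℕ.≤ k → fromℕ j ≤ fromℕ k
    fromℕ-mono {k = k} z≤n = fromℕ-nonneg k
    fromℕ-mono (s≤s p)     = +-monoʳ-≤ 1# (fromℕ-mono p)

    fromℤ-mono : ∀ {j k} → j ℤ.≤ k → fromℤ j ≤ fromℤ k
    fromℤ-mono (ℤ.-≤- p) = -‿anti-≤ (fromℕ-mono (s≤s p))
    fromℤ-mono { -[1+ j ]} {+ k} ℤ.-≤+ = begin
      - fromℕ (suc j) ≤⟨ -‿anti-≤ (fromℕ-nonneg (suc j)) ⟩
      - 0#            ≈⟨ -0#≈0# ⟩
      0#              ≤⟨ fromℕ-nonneg k ⟩
      fromℕ k         ∎
    fromℤ-mono (ℤ.+≤+ p) = fromℕ-mono p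

    fromℤ-suc : ∀ k → fromℤ (ℤ.suc k) ≈ 1# + fromℤ k
    fromℤ-suc (+ k)        = refl
    fromℤ-suc -[1+ zero ]  = sym (trans (+-congˡ (-‿cong (+-identityʳ 1#)))
                                        (-‿inverseʳ 1#))
    fromℤ-suc -[1+ suc k ] = sym (begin-equality
      1# - (1# + x)       ≈⟨ +-congˡ (-‿+-comm 1# x) ⟨
      1# + (- 1# + (- x)) ≈⟨ +-assoc 1# (- 1#) (- x) ⟨
      (1# - 1#) - x       ≈⟨ +-congʳ (-‿inverseʳ 1#) ⟩
      0# - x              ≈⟨ +-identityˡ (- x) ⟩
      - x                 ∎)
      where x = fromℕ (suc k)

    ¬∀⇒∃ : ∀ {A : Set} {P Q : Pred A 0ℓ} →
           ¬ (∀ x → P x → Q x) → ∃ λ x → P x × ¬ Q x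
    ¬∀⇒∃ {A} {P} {Q} ¬h with em {∃ λ x → P x × ¬ Q x}
    ... | yes w = w
    ... | no ¬w = ⊥-elim (¬h λ x p → h x p)
      where
      h : ∀ x → P x → Q x
      h x p with em {Q x}
      ... | yes q = q
      ... | no ¬q = ⊥-elim (¬w (x , p , ¬q))

    x-1≱x : ∀ x → ¬ (x ≤ x - 1#)
    x-1≱x x p = 1≰0 (begin
      1#            ≈⟨ x-y+y≈x 1# x ⟨
      (1# - x) + x  ≈⟨ +-comm (1# - x) x ⟩
      x + (1# - x)  ≈⟨ +-assoc x 1# (- x) ⟨
      (x + 1#) - x  ≤⟨ +-monoˡ-≤ (- x) (x≤y-z⇒x+z≤y p) ⟩
      x - x         ≈⟨ -‿inverseʳ x ⟩
      0#            ∎)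

    approximation : ∀ {S s} → IsSupremum _≤_ S s → ∀ t → ¬ (s ≤ t) →
                    ∃ λ x → S x × ¬ (x ≤ t)
    approximation (_ , least) t s≰t = ¬∀⇒∃ λ h → s≰t (least t h)

    archimedean : ∀ x → ∃ λ k → x ≤ fromℕ k
    archimedean x with em {∃ λ k → x ≤ fromℕ k}
    ... | yes w = w
    ... | no ¬w = ⊥-elim (absurd (approximation s-sup (s - 1#) (x-1≱x s)))
      where
      Naturals : Pred ℝ 0ℓ
      Naturals y = ∃ λ k → y ≈ fromℕ k

      bounded : UpperBound _≤_ Naturals x
      bounded y (k , e) = ≰⇒≥ λ x≤y → ¬w (k , ≤-trans x≤y (≤-reflexive e))

      sup-exists : ∃ (IsSupremum _≤_ Naturals)
      sup-exists = completeness Naturals (0# , zero , refl) (x , bounded)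

      s : ℝ
      s = proj₁ sup-exists

      s-sup : IsSupremum _≤_ Naturals s
      s-sup = proj₂ sup-exists

      absurd : ¬ (∃ λ y → Naturals y × ¬ (y ≤ s - 1#))
      absurd (y , (k , e) , y≰) = y≰ (x+z≤y⇒x≤y-z (begin
        y + 1#       ≈⟨ +-congʳ e ⟩
        fromℕ k + 1# ≈⟨ +-comm (fromℕ k) 1# ⟩
        fromℕ (suc k) ≤⟨ proj₁ s-sup _ (suc k , refl) ⟩
        s            ∎))

    floor : ∀ x → ∃ λ k → fromℤ k ≤ x × x ≤ fromℤ (ℤ.suc k)
    floor x = result (approximation s-sup (s - 1#) (x-1≱x s))
      where
      Below : Pred ℝ 0ℓ
      Below y = ∃ λ k → y ≈ fromℤ k × fromℤ k ≤ x

      inhabited : ∃ Below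
      inhabited with archimedean (- x)
      ... | k , p = fromℤ (ℤ.- (+ k)) , ℤ.- (+ k) , refl , lemma k p
        where
        lemma : ∀ k → - x ≤ fromℕ k → fromℤ (ℤ.- (+ k)) ≤ x
        lemma zero p = begin
          0#    ≈⟨ -0#≈0# ⟨
          - 0#  ≤⟨ -‿anti-≤ p ⟩
          - - x ≈⟨ -‿involutive x ⟩
          x     ∎
        lemma (suc k) p = begin
          - fromℕ (suc k) ≤⟨ -‿anti-≤ p ⟩
          - - x           ≈⟨ -‿involutive x ⟩
          x               ∎

      sup-exists : ∃ (IsSupremum _≤_ Below)
      sup-exists = completeness Below inhabited
        (x , λ y (k , e , p) → ≤-trans (≤-reflexive e) p)

      s : ℝ
      s = proj₁ sup-exists

      s-sup : IsSupremum _≤_ Below s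
      s-sup = proj₂ sup-exists

      result : (∃ λ y → Below y × ¬ (y ≤ s - 1#)) →
               ∃ λ k → fromℤ k ≤ x × x ≤ fromℤ (ℤ.suc k)
      result (y , (k , e , p) , y≰) = k , p , ≰⇒≥ λ q → y≰ (x+z≤y⇒x≤y-z (begin
        y + 1#            ≈⟨ +-congʳ e ⟩
        fromℤ k + 1#      ≈⟨ +-comm (fromℤ k) 1# ⟩
        1# + fromℤ k      ≈⟨ fromℤ-suc k ⟨
        fromℤ (ℤ.suc k)   ≤⟨ proj₁ s-sup _ (ℤ.suc k , refl , q) ⟩
        s                 ∎))

    nearest : ∀ x → ∃ λ p → ∀ q → ∣ x - fromℤ p ∣ ≤ ∣ x - fromℤ q ∣
    nearest x = choose (floor x)
      where
      below : ∀ {j k} → j ℤ.≤ k → fromℤ k ≤ x →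
              ∣ x - fromℤ k ∣ ≤ ∣ x - fromℤ j ∣
      below {j} {k} j≤k k≤x = ≤-trans
        (⊔-lub ≤-refl (begin
          - (x - fromℤ k) ≈⟨ neg-minus x (fromℤ k) ⟩
          fromℤ k - x     ≤⟨ +-mono-≤ k≤x (-‿anti-≤ k≤x) ⟩
          x - fromℤ k     ∎))
        (≤-trans (+-monoʳ-≤ x (-‿anti-≤ (fromℤ-mono j≤k))) (x≤∣x∣ _))

      above : ∀ {j k} → k ℤ.≤ j → x ≤ fromℤ k →
              ∣ x - fromℤ k ∣ ≤ ∣ x - fromℤ j ∣
      above {j} {k} k≤j x≤k = begin
        ∣ x - fromℤ k ∣ ≤⟨ ⊔-lub
            (+-mono-≤ x≤k (-‿anti-≤ x≤k))
            (≤-reflexive (neg-minus x (fromℤ k))) ⟩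
        fromℤ k - x     ≤⟨ +-monoˡ-≤ (- x) (fromℤ-mono k≤j) ⟩
        fromℤ j - x     ≈⟨ neg-minus x (fromℤ j) ⟨
        - (x - fromℤ j) ≤⟨ -x≤∣x∣ _ ⟩
        ∣ x - fromℤ j ∣ ∎

      choose : (∃ λ k → fromℤ k ≤ x × x ≤ fromℤ (ℤ.suc k)) →
               ∃ λ p → ∀ q → ∣ x - fromℤ p ∣ ≤ ∣ x - fromℤ q ∣
      choose (k , k≤x , x≤k+1)
        with total ∣ x - fromℤ k ∣ ∣ x - fromℤ (ℤ.suc k) ∣
      ... | inj₁ c = k , λ q → case q (q ℤ.≤? k)
        where
        case : ∀ q → Dec (q ℤ.≤ k) → ∣ x - fromℤ k ∣ ≤ ∣ x - fromℤ q ∣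
        case q (yes p) = below p k≤x
        case q (no ¬p) =
          ≤-trans c (above (ℤₚ.i<j⇒suc[i]≤j (ℤₚ.≰⇒> ¬p)) x≤k+1)
      ... | inj₂ c = ℤ.suc k , λ q → case q (q ℤ.≤? k)
        where
        case : ∀ q → Dec (q ℤ.≤ k) →
               ∣ x - fromℤ (ℤ.suc k) ∣ ≤ ∣ x - fromℤ q ∣
        case q (yes p) = ≤-trans c (below p k≤x)
        case q (no ¬p) = above (ℤₚ.i<j⇒suc[i]≤j (ℤₚ.≰⇒> ¬p)) x≤k+1

  -- Absolute values are nonnegative, so starting the fold at 0 does not change
  -- the maximum of a nonempty vector.

  ‖_‖ : ∀ {k} → Vec ℝ k → ℝ
  ‖ x ‖ = Vec.foldr′ _⊔_ 0# (Vec.map ∣_∣ x)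

  ‖_‖ℤ : ∀ {k} → Vec ℤ k → ℕ
  ‖ q ‖ℤ = Vec.foldr′ ℕ._⊔_ 0 (Vec.map ℤ.∣_∣ q)

  _⊖_ : ∀ {k} → Vec ℝ k → Vec ℝ k → Vec ℝ k
  _⊖_ = Vec.zipWith _-_

  fromℤᵛ : ∀ {k} → Vec ℤ k → Vec ℝ k
  fromℤᵛ = Vec.map fromℤ

  Matrix : ℕ → ℕ → Set
  Matrix m n = Vec (Vec ℝ n) m

  dot : ∀ {k} → Vec ℝ k → Vec ℝ k → ℝ
  dot x y = Vec.foldr′ _+_ 0# (Vec.zipWith _*_ x y)

  _·ᵛ_ : ∀ {m n} → Matrix m n → Vec ℝ n → Vec ℝ m
  A ·ᵛ x = Vec.map (λ row → dot row x) A

  minimiser : ∀ {k} (y : Vec ℝ k) →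
              ∃ λ p → ∀ q → ‖ y ⊖ fromℤᵛ p ‖ ≤ ‖ y ⊖ fromℤᵛ q ‖
  minimiser []       = [] , λ { [] → ≤-refl }
  minimiser (x ∷ y) with Lemmas.nearest x | minimiser y
  ... | p , h | ps , hs = p ∷ ps , λ { (q ∷ qs) → ⊔-mono-≤ (h q) (hs qs) }

  -- The minimum of ‖ y - p ‖ over p ∈ ℤᵏ, by the choice of minimiser.
  ⟨_⟩ : ∀ {k} → Vec ℝ k → ℝ
  ⟨ y ⟩ = ‖ y ⊖ fromℤᵛ (proj₁ (minimiser y)) ‖

  supremum± : (S : Pred (ℝ ±) 0ℓ) → ∃ (IsSupremum _≤±_ S)
  supremum± S with em {S ⊤±}
  ... | yes t = ⊤± , (λ x _ → x ≤±.≤⊤±)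
                   , (λ u h → h ⊤± t)
  ... | no ¬t with em {∃ λ x → S [ x ]}
  ...   | no ¬x = ⊥± , bound , λ u _ → ≤±.⊥±≤ u
    where
    bound : UpperBound _≤±_ S ⊥±
    bound ⊥±    _ = ≤±.⊥±≤⊥±
    bound [ x ] s = ⊥-elim (¬x (x , s))
    bound ⊤±    s = ⊥-elim (¬t s)
  ...   | yes (x₀ , s₀) with em {∃ (UpperBound _≤_ (λ x → S [ x ]))}
  ...     | no ¬b = ⊤± , (λ x _ → x ≤±.≤⊤±) , least
    where
    least : ∀ u → UpperBound _≤±_ S u → ⊤± ≤± u
    least ⊤±    _ = ≤±.⊤±≤⊤±
    least [ u ] h = ⊥-elim (¬b (u , λ x s →
      ≤±.[≤]-injective (h [ x ] s)))
    least ⊥±    h with h [ x₀ ] s₀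
    ... | ≤⁺.[ () ]
  ...     | yes b with completeness (λ x → S [ x ]) (x₀ , s₀) b
  ...       | s , ub , lub = [ s ] , bound , least
    where
    bound : UpperBound _≤±_ S [ s ]
    bound ⊥±    _ = ≤±.⊥±≤[ s ]
    bound [ x ] p = ≤±.[ ub x p ]
    bound ⊤±    p = ⊥-elim (¬t p)

    least : ∀ u → UpperBound _≤±_ S u → [ s ] ≤± u
    least ⊤±    _ = [ s ] ≤±.≤⊤±
    least [ u ] h = ≤±.[ lub u (λ x p →
      ≤±.[≤]-injective (h [ x ] p)) ]
    least ⊥±    h with h [ x₀ ] s₀
    ... | ≤⁺.[ () ]

  infimum± : (S : Pred (ℝ ±) 0ℓ) → ∃ (IsInfimum _≤±_ S)
  infimum± S with supremum± (UpperBound (flip _≤±_) S)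
  ... | i , ub , lub = i , (λ x s → lub x (λ l h → h x s)) , ub

  sup± inf± : Pred (ℝ ±) 0ℓ → ℝ ±
  sup± S = proj₁ (supremum± S)
  inf± S = proj₁ (infimum± S)

  -- The limit over N → ∞ of the infima over ‖q‖ ≥ N, which increase with N; it may
  -- be +∞.
  liminf : ∀ {n} → (Vec ℤ n → ℝ) → ℝ ±
  liminf f = sup± λ v → ∃ λ N →
    v ≡ inf± (λ w → ∃ λ q → N ℕ.≤ ‖ q ‖ℤ × w ≡ [ f q ])

  -- The domain of ψ is {1, 2, 3, …}: the series start at q = 1, and a value at
  -- 0 would not be seen by d.
  Sequence⁺ : Set
  Sequence⁺ = (q : ℕ) .{{_ : NonZero q}} → ℝ

  partialSum : Sequence⁺ → ℕ → ℝ
  partialSum a zero    = 0#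
  partialSum a (suc N) = partialSum a N + a (suc N)

  _⟶_ : (ℕ → ℝ) → ℝ → Set
  s ⟶ l = ∀ ε → 0# < ε → ∃ λ N → ∀ k → N ℕ.≤ k → ∣ s k - l ∣ < ε

  Summable : Sequence⁺ → Set
  Summable a = ∃ λ l → partialSum a ⟶ l

  module _ where

    open Lemmas
    open PosetReasoning poset

    partialSum-mono : ∀ {a : Sequence⁺} → (∀ q .{{_ : NonZero q}} → 0# ≤ a q) →
                      ∀ {j k} → j ℕ.≤′ k → partialSum a j ≤ partialSum a k
    partialSum-mono a≥0 (ℕ.≤′-reflexive ≡.refl) = ≤-refl
    partialSum-mono {a} a≥0 {j} (ℕ.≤′-step {k} p) = begin
      partialSum a j             ≤⟨ partialSum-mono {a} a≥0 p ⟩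
      partialSum a k             ≈⟨ +-identityʳ _ ⟨
      partialSum a k + 0#        ≤⟨ +-monoʳ-≤ _ (a≥0 (suc k)) ⟩
      partialSum a k + a (suc k) ∎

    partialSum≤limit : ∀ {a : Sequence⁺} → (∀ q .{{_ : NonZero q}} → 0# ≤ a q) →
                       ∀ {l} → partialSum a ⟶ l → ∀ N → partialSum a N ≤ l
    partialSum≤limit {a} a≥0 {l} lim N with em {partialSum a N ≤ l}
    ... | yes p = p
    ... | no ¬p with lim (partialSum a N - l)
                         (≰⇒< (λ q → ¬p (≤-trans (x-z≤y⇒x≤y+z q)
                           (≤-reflexive (+-identityˡ l)))))
    ...   | M , h = ⊥-elim (<⇒≱ (h (M ℕ.⊔ N) (ℕₚ.m≤m⊔n M N))
      (≤-trans
        (+-monoˡ-≤ (- l)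
          (partialSum-mono {a} a≥0 (ℕₚ.≤⇒≤′ (ℕₚ.m≤n⊔m M N))))
        (x≤∣x∣ _)))

    bounded⇒summable : ∀ {a : Sequence⁺} → (∀ q .{{_ : NonZero q}} → 0# ≤ a q) →
                       ∀ {b} → (∀ N → partialSum a N ≤ b) → Summable a
    bounded⇒summable {a} a≥0 {b} bd = s , converges
      where
      Sums : Pred ℝ 0ℓ
      Sums x = ∃ λ N → x ≈ partialSum a N

      sup-exists : ∃ (IsSupremum _≤_ Sums)
      sup-exists = completeness Sums (0# , 0 , refl)
        (b , λ x (N , e) → ≤-trans (≤-reflexive e) (bd N))

      s : ℝ
      s = proj₁ sup-exists

      s-sup : IsSupremum _≤_ Sums s
      s-sup = proj₂ sup-exists

      upper : ∀ N → partialSum a N ≤ s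
      upper N = proj₁ s-sup _ (N , refl)

      converges : partialSum a ⟶ s
      converges ε 0<ε with approximation s-sup (s - ε)
        (λ p → <⇒≱ 0<ε (begin
          ε           ≈⟨ x+y-y≈x ε s ⟨
          (ε + s) - s ≤⟨ +-monoˡ-≤ (- s)
              (≤-trans (≤-reflexive (+-comm ε s)) (x≤y-z⇒x+z≤y p)) ⟩
          s - s       ≈⟨ -‿inverseʳ s ⟩
          0#          ∎))
      ... | x , (N , e) , x≰ = N , λ k N≤k → ≰⇒< λ ε≤ → x≰ (begin
        x              ≈⟨ e ⟩
        partialSum a N ≤⟨ partialSum-mono {a} a≥0 (ℕₚ.≤⇒≤′ N≤k) ⟩
        partialSum a k ≤⟨ close k ε≤ ⟩
        s - ε          ∎)
        where
        close : ∀ k → ε ≤ ∣ partialSum a k - s ∣ → partialSum a k ≤ s - ε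
        close k ε≤ = x+z≤y⇒x≤y-z (begin
          partialSum a k + ε ≤⟨ +-monoʳ-≤ _ (≤-trans ε≤ (⊔-lub
              (+-mono-≤ (upper k) (-‿anti-≤ (upper k)))
              (≤-reflexive (neg-minus _ s)))) ⟩
          partialSum a k + (s - partialSum a k) ≈⟨ +-comm _ _ ⟩
          (s - partialSum a k) + partialSum a k ≈⟨ x-y+y≈x s _ ⟩
          s                  ∎)

    comparison : ∀ {a b c : Sequence⁺} →
                 (∀ q .{{_ : NonZero q}} → 0# ≤ a q) →
                 (∀ q .{{_ : NonZero q}} → 0# ≤ b q) →
                 (∀ q .{{_ : NonZero q}} → 0# ≤ c q) →
                 (∀ q .{{_ : NonZero q}} → c q ≤ a q + b q) →
                 Summable a → Summable b → Summable c
    comparison {a} {b} {c} a≥0 b≥0 c≥0 c≤ (l , la) (r , rb) =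
      bounded⇒summable {c} c≥0 λ N → ≤-trans (sums N)
        (+-mono-≤ (partialSum≤limit {a} a≥0 la N)
                  (partialSum≤limit {b} b≥0 rb N))
      where
      sums : ∀ N → partialSum c N ≤ partialSum a N + partialSum b N
      sums zero    = ≤-reflexive (sym (+-identityˡ 0#))
      sums (suc N) = begin
        partialSum c N + c (suc N)
          ≤⟨ +-mono-≤ (sums N) (c≤ (suc N)) ⟩
        (partialSum a N + partialSum b N) + (a (suc N) + b (suc N))
          ≈⟨ +-assoc _ _ _ ⟩
        partialSum a N + (partialSum b N + (a (suc N) + b (suc N)))
          ≈⟨ +-congˡ (trans (sym (+-assoc _ _ _))
               (trans (+-congʳ (+-comm _ _)) (+-assoc _ _ _))) ⟩
        partialSum a N + (a (suc N) + (partialSum b N + b (suc N)))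
          ≈⟨ +-assoc _ _ _ ⟨
        (partialSum a N + a (suc N)) + (partialSum b N + b (suc N))
          ∎

  record 𝒞 (m n : ℕ) : Set where
    field
      ψ          : Sequence⁺
      nonneg     : ∀ q .{{_ : NonZero q}} → 0# ≤ ψ q
      decreasing : ∀ p q .{{_ : NonZero p}} .{{_ : NonZero q}} →
                   p ℕ.≤ q → ψ q ≤ ψ p
      summable   : Summable (λ q → fromℕ q ^ (n ∸ 1) * ψ q ^ m)

  difference-summable : ∀ {m n} (φ₁ φ₂ : 𝒞 m n) →
    Summable (λ q → fromℕ q ^ (n ∸ 1) * ∣ 𝒞.ψ φ₁ q ^ m - 𝒞.ψ φ₂ q ^ m ∣)
  difference-summable {m} {n} φ₁ φ₂ = comparison
    {λ q → w q * F.ψ q ^ m} {λ q → w q * G.ψ q ^ m}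
    (λ q → *-nonneg (w≥0 q) (Fm≥0 q))
    (λ q → *-nonneg (w≥0 q) (Gm≥0 q))
    (λ q → *-nonneg (w≥0 q) (0≤∣x∣ _))
    (λ q → termwise (w≥0 q) (Fm≥0 q) (Gm≥0 q))
    F.summable G.summable
    where
    open Lemmas
    open PosetReasoning poset
    module F = 𝒞 φ₁
    module G = 𝒞 φ₂

    w : ℕ → ℝ
    w q = fromℕ q ^ (n ∸ 1)

    w≥0 : ∀ q → 0# ≤ w q
    w≥0 q = ^-nonneg (n ∸ 1) (fromℕ-nonneg q)

    Fm≥0 : ∀ q .{{_ : NonZero q}} → 0# ≤ F.ψ q ^ m
    Fm≥0 q = ^-nonneg m (F.nonneg q)

    Gm≥0 : ∀ q .{{_ : NonZero q}} → 0# ≤ G.ψ q ^ m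
    Gm≥0 q = ^-nonneg m (G.nonneg q)

    *-monoʳ : ∀ {v x y} → 0# ≤ v → x ≤ y → v * x ≤ v * y
    *-monoʳ {v} {x} {y} v≥0 p = begin
      v * x                 ≈⟨ +-identityˡ _ ⟨
      0# + v * x            ≤⟨ +-monoˡ-≤ _ (*-nonneg v≥0 (x+z≤y⇒x≤y-z
                                 (≤-trans (≤-reflexive (+-identityˡ x)) p))) ⟩
      v * (y - x) + v * x   ≈⟨ distribˡ v (y - x) x ⟨
      v * ((y - x) + x)     ≈⟨ *-congˡ (x-y+y≈x y x) ⟩
      v * y                 ∎

    termwise : ∀ {v x y} → 0# ≤ v → 0# ≤ x → 0# ≤ y →
               v * ∣ x - y ∣ ≤ v * x + v * y
    termwise {v} {x} {y} v≥0 p q = begin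
      v * ∣ x - y ∣ ≤⟨ *-monoʳ v≥0 (∣x-y∣≤x+y p q) ⟩
      v * (x + y)   ≈⟨ distribˡ v x y ⟩
      v * x + v * y ∎

  d : ∀ {m n} → 𝒞 m n → 𝒞 m n → ℝ
  d φ₁ φ₂ = proj₁ (difference-summable φ₁ φ₂)

  -- ψ(‖q‖) is defined only for q ≠ 0; leaving out the single point q = 0 does not
  -- affect infinitude.
  𝒞⟨_,_⟩ : ∀ {m n} → Matrix m n → Vec ℝ m → Pred (𝒞 m n) 0ℓ
  𝒞⟨ A , γ ⟩ φ = Infinite λ q →
    Σ (NonZero ‖ q ‖ℤ) λ nz →
      ⟨ (A ·ᵛ fromℤᵛ q) ⊖ γ ⟩ < 𝒞.ψ φ ‖ q ‖ℤ {{nz}}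

  Bad : ∀ m n → Pred (Matrix m n × Vec ℝ m) 0ℓ
  Bad m n (A , γ) =
    [ 0# ] <± liminf λ q →
      fromℕ ‖ q ‖ℤ ^ n * ⟨ (A ·ᵛ fromℤᵛ q) ⊖ γ ⟩ ^ m

  [0,1⟩ : Pred ℝ 0ℓ
  [0,1⟩ x = 0# ≤ x × x < 1#

  module Topology {X : Set} (dist : X → X → ℝ) where

    Open Closed Dense : Pred X 0ℓ → Set
    Open U   = ∀ x → U x → ∃ λ ε → 0# < ε × (∀ y → dist x y < ε → U y)
    Closed F = Open (∁ F)
    Dense S  = ∀ x ε → 0# < ε → ∃ λ y → S y × dist x y < ε

    IsGδ IsFσ : Pred X 0ℓ → Set₁
    IsGδ S = ∃ λ (U : ℕ → Pred X 0ℓ) → (∀ k → Open (U k)) × S ≐ ⋂ ℕ U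
    IsFσ S = ∃ λ (F : ℕ → Pred X 0ℓ) → (∀ k → Closed (F k)) × S ≐ ⋃ ℕ F

{-# OPTIONS --safe #-}

-- The solvability sets U_k = {ψ : some q with ‖q‖ ≥ k has f(q) < ψ(‖q‖)}, where
-- f(q) = ⟨Aq − γ⟩, are open and have intersection 𝒞⟨A,γ⟩.  Joining θ·1_[1,N] to a function
-- moves it by at most Nⁿθᵐ, so by the failure of badness a new solution q of arbitrarily
-- large norm is obtained at arbitrarily small cost.  Infinitely many such joins, with
-- decreasing heights θ, give density.  If 𝒞⟨A,γ⟩ were the union of closed F_k, then
-- starting from 0 every finite stage would lie outside 𝒞⟨A,γ⟩, hence have a ball avoiding
-- F_k; keeping the remaining costs below its radius, as in Baire's theorem, the limit would
-- lie in 𝒞⟨A,γ⟩ but in no F_k.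

module Submission where

open import Defs
open import Algebra.Bundles using (CommutativeRing)
import Algebra.Construct.NaturalChoice.Max as Max
import Algebra.Properties.CommutativeSemigroup as CommutativeSemigroupProperties
import Algebra.Properties.CommutativeSemiring.Exp as Exp
import Algebra.Properties.Ring as RingProperties
open import Axiom.ExcludedMiddle using (ExcludedMiddle)
open import Data.Empty using (⊥-elim)
open import Data.Integer as ℤ using (ℤ; +_; -[1+_])
open import Data.List as List using (List; upTo)
import Data.List.Extrema as Extrema
open import Data.List.Membership.Propositional using (_∈_)
open import Data.List.Membership.Propositional.Properties
  using (∈-map⁺; ∈-++⁺ˡ; ∈-++⁺ʳ; ∈-upTo⁺; ∈-cartesianProductWith⁺)
open import Data.List.Relation.Unary.Any using (here)
import Data.List.Relation.Unary.All as ListAll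
open import Data.Nat as ℕ using (ℕ; zero; suc; NonZero; _∸_)
import Data.Nat.Properties as ℕₚ
open import Data.Product using (Σ; ∃; _×_; _,_; proj₁; proj₂)
open import Data.Sum using (inj₁; inj₂; [_,_]′)
open import Data.Unit using (⊤)
open import Data.Vec as Vec using (Vec; []; _∷_)
open import Data.Vec.Relation.Unary.All using (All)
open import Level using (0ℓ)
import Relation.Binary.Construct.Add.Extrema.NonStrict as AddExtremaNonStrict
import Relation.Binary.Construct.Add.Extrema.Strict as AddExtremaStrict
import Relation.Binary.Construct.Add.Supremum.NonStrict as ≤⁺
import Relation.Binary.Reasoning.PartialOrder as PosetReasoning
open import Relation.Binary.PropositionalEquality as ≡ using (_≡_)
open import Relation.Nullary using (¬_; yes; no)
open import Relation.Nullary.Construct.Add.Extrema using (_±; ⊥±; ⊤±; [_])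
open import Relation.Unary using (Pred; ∁; _⊆_)

-- Strict order, products and powers in an ordered field.

module RealProperties (em : ExcludedMiddle 0ℓ) (ℝ-field : CompleteOrderedField) where

  open Real em ℝ-field
  open Lemmas
  open Max totalOrder using (⊔-sel)
  open RingProperties ring using (x[y-z]≈xy-xz)
  open Exp (CommutativeRing.commutativeSemiring commutativeRing)
    using (^-congˡ; ^-distrib-*)
  open PosetReasoning poset

  ¬∀¬⇒∃ : ∀ {A : Set} {P : Pred A 0ℓ} → ¬ (∀ x → ¬ P x) → ∃ P
  ¬∀¬⇒∃ {P = P} h with em {∃ P}
  ... | yes w = w
  ... | no ¬w = ⊥-elim (h λ x p → ¬w (x , p))

  ≮⇒≥ : ∀ {x y} → ¬ (x < y) → y ≤ x
  ≮⇒≥ {x} {y} ¬p with em {y ≤ x}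
  ... | yes q = q
  ... | no ¬q = ⊥-elim (¬p (≰⇒< ¬q))

  <-≤-trans : ∀ {x y z} → x < y → y ≤ z → x < z
  <-≤-trans p q = ≰⇒< λ r → <⇒≱ p (≤-trans q r)

  ≤-<-trans : ∀ {x y z} → x ≤ y → y < z → x < z
  ≤-<-trans p q = ≰⇒< λ r → <⇒≱ q (≤-trans r p)

  0<1 : 0# < 1#
  0<1 = ≰⇒< 1≰0

  +-cancelʳ-≤ : ∀ {x y} z → x + z ≤ y + z → x ≤ y
  +-cancelʳ-≤ {x} {y} z p = begin
    x           ≈⟨ x+y-y≈x x z ⟨
    (x + z) - z ≤⟨ x≤y+z⇒x-z≤y p ⟩
    y           ∎

  x≤x+y : ∀ {x y} → 0# ≤ y → x ≤ x + y
  x≤x+y {x} {y} p = begin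
    x      ≈⟨ +-identityʳ x ⟨
    x + 0# ≤⟨ +-monoʳ-≤ x p ⟩
    x + y  ∎

  *-monoʳ-≤ : ∀ {v x y} → 0# ≤ v → x ≤ y → v * x ≤ v * y
  *-monoʳ-≤ {v} {x} {y} v≥0 p = begin
    v * x      ≈⟨ +-identityˡ _ ⟨
    0# + v * x ≤⟨ x≤y-z⇒x+z≤y (begin
      0#            ≤⟨ *-nonneg v≥0 (x+z≤y⇒x≤y-z
                         (≤-trans (≤-reflexive (+-identityˡ x)) p)) ⟩
      v * (y - x)   ≈⟨ x[y-z]≈xy-xz v y x ⟩
      v * y - v * x ∎) ⟩
    v * y      ∎

  *-monoˡ-≤ : ∀ {v x y} → 0# ≤ v → x ≤ y → x * v ≤ y * v
  *-monoˡ-≤ {v} {x} {y} v≥0 p = begin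
    x * v ≈⟨ *-comm x v ⟩
    v * x ≤⟨ *-monoʳ-≤ v≥0 p ⟩
    v * y ≈⟨ *-comm v y ⟩
    y * v ∎

  -- Since `<` is `≤` together with `≉`, strictness amounts to `x * y` differing from zero, which
  -- follows by multiplying with the inverse of `y`.
  *-pos : ∀ {x y} → 0# < x → 0# < y → 0# < x * y
  *-pos {x} {y} (x≥0 , x≉0) (y≥0 , y≉0) with inverse y (λ e → y≉0 (sym e))
  ... | y⁻¹ , yy⁻¹≈1 = *-nonneg x≥0 y≥0 , λ 0≈xy → x≉0 (begin-equality
    0#            ≈⟨ zeroˡ y⁻¹ ⟨
    0# * y⁻¹      ≈⟨ *-congʳ 0≈xy ⟩
    (x * y) * y⁻¹ ≈⟨ *-assoc x y y⁻¹ ⟩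
    x * (y * y⁻¹) ≈⟨ *-congˡ yy⁻¹≈1 ⟩
    x * 1#        ≈⟨ *-identityʳ x ⟩
    x             ∎)

  inverse-pos : ∀ {x y} → 0# ≤ x → x * y ≈ 1# → 0# < y
  inverse-pos {x} {y} x≥0 xy≈1 = ≰⇒< λ y≤0 → 1≰0 (begin
    1#     ≈⟨ xy≈1 ⟨
    x * y  ≤⟨ *-monoʳ-≤ x≥0 y≤0 ⟩
    x * 0# ≈⟨ zeroʳ x ⟩
    0#     ∎)

  *-monoʳ-< : ∀ {v x y} → 0# < v → x < y → v * x < v * y
  *-monoʳ-< {v} {x} {y} v>0@(v≥0 , v≉0) (x≤y , x≉y)
    with inverse v (λ e → v≉0 (sym e))
  ... | v⁻¹ , vv⁻¹≈1 = *-monoʳ-≤ v≥0 x≤y , λ e → x≉y (begin-equality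
    x             ≈⟨ undo x ⟨
    v⁻¹ * (v * x) ≈⟨ *-congˡ e ⟩
    v⁻¹ * (v * y) ≈⟨ undo y ⟩
    y             ∎)
    where
    undo : ∀ z → v⁻¹ * (v * z) ≈ z
    undo z = begin-equality
      v⁻¹ * (v * z) ≈⟨ *-assoc v⁻¹ v z ⟨
      (v⁻¹ * v) * z ≈⟨ *-congʳ (trans (*-comm v⁻¹ v) vv⁻¹≈1) ⟩
      1# * z        ≈⟨ *-identityˡ z ⟩
      z             ∎

  ^-pos : ∀ {x} k → 0# < x → 0# < x ^ k
  ^-pos zero    p = 0<1
  ^-pos (suc k) p = *-pos p (^-pos k p)

  ^-monoˡ-≤ : ∀ {x y} k → 0# ≤ x → x ≤ y → x ^ k ≤ y ^ k
  ^-monoˡ-≤ zero    x≥0 p = ≤-refl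
  ^-monoˡ-≤ (suc k) x≥0 p = ≤-trans
    (*-monoˡ-≤ (^-nonneg k x≥0) p)
    (*-monoʳ-≤ (≤-trans x≥0 p) (^-monoˡ-≤ k x≥0 p))

  ^-monoˡ-< : ∀ {x y} k .{{_ : NonZero k}} → 0# ≤ x → x < y → x ^ k < y ^ k
  ^-monoˡ-< {x} {y} (suc k) x≥0 p = begin-strict
    x * x ^ k ≤⟨ *-monoʳ-≤ x≥0 (^-monoˡ-≤ k x≥0 (proj₁ p)) ⟩
    x * y ^ k ≈⟨ *-comm x _ ⟩
    y ^ k * x <⟨ *-monoʳ-< (^-pos k (≤-<-trans x≥0 p)) p ⟩
    y ^ k * y ≈⟨ *-comm _ y ⟩
    y * y ^ k ∎

  x≤1⇒x^k≤1 : ∀ {x} k → 0# ≤ x → x ≤ 1# → x ^ k ≤ 1#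
  x≤1⇒x^k≤1 zero        x≥0 p = ≤-refl
  x≤1⇒x^k≤1 {x} (suc k) x≥0 p = begin
    x * x ^ k ≤⟨ *-monoʳ-≤ x≥0 (x≤1⇒x^k≤1 k x≥0 p) ⟩
    x * 1#    ≈⟨ *-identityʳ x ⟩
    x         ≤⟨ p ⟩
    1#        ∎

  1≤x⇒1≤x^k : ∀ {x} k → 1# ≤ x → 1# ≤ x ^ k
  1≤x⇒1≤x^k zero        p = ≤-refl
  1≤x⇒1≤x^k {x} (suc k) p = begin
    1#        ≤⟨ p ⟩
    x         ≈⟨ *-identityʳ x ⟨
    x * 1#    ≤⟨ *-monoʳ-≤ (≤-trans 0≤1 p) (1≤x⇒1≤x^k k p) ⟩
    x * x ^ k ∎

  -- Serves in place of roots: a small base has a small power. At `x = 0#` it says that a positive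
  -- power of zero is at most zero.
  x≤1⇒x^k≤x : ∀ {x} k .{{_ : NonZero k}} → 0# ≤ x → x ≤ 1# → x ^ k ≤ x
  x≤1⇒x^k≤x {x} (suc k) x≥0 p = begin
    x * x ^ k ≤⟨ *-monoʳ-≤ x≥0 (x≤1⇒x^k≤1 k x≥0 p) ⟩
    x * 1#    ≈⟨ *-identityʳ x ⟩
    x         ∎

  1≤fromℕ : ∀ k .{{_ : NonZero k}} → 1# ≤ fromℕ k
  1≤fromℕ (suc k) = x≤x+y (fromℕ-nonneg k)

  ⊔-^-≤ : ∀ {x y} k → 0# ≤ x → 0# ≤ y → (x ⊔ y) ^ k ≤ x ^ k + y ^ k
  ⊔-^-≤ {x} {y} k x≥0 y≥0 with ⊔-sel x y
  ... | inj₁ e = begin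
    (x ⊔ y) ^ k   ≈⟨ ^-congˡ k e ⟩
    x ^ k         ≤⟨ x≤x+y (^-nonneg k y≥0) ⟩
    x ^ k + y ^ k ∎
  ... | inj₂ e = begin
    (x ⊔ y) ^ k   ≈⟨ ^-congˡ k e ⟩
    y ^ k         ≤⟨ x≤x+y (^-nonneg k x≥0) ⟩
    y ^ k + x ^ k ≈⟨ +-comm _ _ ⟩
    x ^ k + y ^ k ∎

  positive-lower-bound : ∀ {x y} → 0# < x → 0# < y →
                         ∃ λ z → 0# < z × z ≤ x × z ≤ y
  positive-lower-bound {x} {y} x>0 y>0 =
    [ (λ x≤y → x , x>0 , ≤-refl , x≤y)
    , (λ y≤x → y , y>0 , y≤x , ≤-refl) ]′ (total x y)

  -- Take `s` as the minimum of 1 and ε/(a + 1); the added 1 keeps the denominator positive when `a`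
  -- is zero.
  small-multiplier : ∀ {a ε} → 0# ≤ a → 0# < ε →
                     ∃ λ s → 0# < s × s ≤ 1# × s * a ≤ ε
  small-multiplier {a} {ε} a≥0 ε>0 = result
    where
    t>0 : 0# < a + 1#
    t>0 = <-≤-trans 0<1 (≤-trans (x≤x+y a≥0) (≤-reflexive (+-comm 1# a)))

    result : ∃ λ s → 0# < s × s ≤ 1# × s * a ≤ ε
    result with inverse (a + 1#) (λ e → proj₂ t>0 (sym e))
    ... | t⁻¹ , tt⁻¹≈1
      with positive-lower-bound (*-pos (inverse-pos (proj₁ t>0) tt⁻¹≈1) ε>0) 0<1
    ... | s , s>0 , s≤ , s≤1 = s , s>0 , s≤1 , (begin
      s * a                ≤⟨ *-monoʳ-≤ (proj₁ s>0) (x≤x+y 0≤1) ⟩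
      s * (a + 1#)         ≤⟨ *-monoˡ-≤ (proj₁ t>0) s≤ ⟩
      t⁻¹ * ε * (a + 1#)   ≈⟨ *-comm _ _ ⟩
      (a + 1#) * (t⁻¹ * ε) ≈⟨ *-assoc _ _ _ ⟨
      (a + 1#) * t⁻¹ * ε   ≈⟨ *-congʳ tt⁻¹≈1 ⟩
      1# * ε               ≈⟨ *-identityˡ ε ⟩
      ε                    ∎)

  x*2≈x+x : ∀ x → x * (1# + 1#) ≈ x + x
  x*2≈x+x x = trans (distribˡ x 1# 1#) (+-cong (*-identityʳ x) (*-identityʳ x))

  0≤2 : 0# ≤ 1# + 1#
  0≤2 = ≤-trans 0≤1 (x≤x+y 0≤1)

  half : ∀ {ε} → 0# < ε → ∃ λ h → 0# < h × h + h ≤ ε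
  half ε>0 =
    let h , h>0 , _ , h≤ = small-multiplier {1# + 1#} 0≤2 ε>0
    in h , h>0 , ≤-trans (≤-reflexive (sym (x*2≈x+x h))) h≤

  x<x+x : ∀ {x} → 0# < x → x < x + x
  x<x+x {x} p = ≰⇒< λ q → <⇒≱ p
    (+-cancelʳ-≤ x (≤-trans q (≤-reflexive (sym (+-identityˡ x)))))

  -- With y = 2 max(x, s) for a small s > 0 no m-th roots are needed.
  overshoot : ∀ k .{{_ : NonZero k}} {x a δ} → 0# ≤ x → 0# ≤ a → 0# < δ → a * x ^ k ≤ δ →
              ∃ λ y → x < y × a * y ^ k ≤ δ * (1# + 1#) ^ k
  overshoot k {x} {a} {δ} x≥0 a≥0 δ>0 ax^k≤δ =
    let s , s>0 , s≤1 , sa≤δ = small-multiplier a≥0 δ>0 in doubled s s>0 s≤1 sa≤δ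
    where
    doubled : ∀ s → 0# < s → s ≤ 1# → s * a ≤ δ →
              ∃ λ y → x < y × a * y ^ k ≤ δ * (1# + 1#) ^ k
    doubled s s>0 s≤1 sa≤δ =
      g + g , ≤-<-trans (x≤x⊔y x s) (x<x+x (<-≤-trans s>0 (x≤y⊔x x s))) , (begin
        a * (g + g) ^ k                 ≈⟨ *-congˡ (^-congˡ k (x*2≈x+x g)) ⟨
        a * (g * (1# + 1#)) ^ k         ≈⟨ *-congˡ (^-distrib-* g (1# + 1#) k) ⟩
        a * (g ^ k * (1# + 1#) ^ k)     ≈⟨ *-assoc a _ _ ⟨
        a * g ^ k * (1# + 1#) ^ k       ≤⟨ *-monoˡ-≤ (^-nonneg k 0≤2) ag^k≤δ ⟩
        δ * (1# + 1#) ^ k               ∎)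
      where
      g = x ⊔ s

      ag^k≤δ : a * g ^ k ≤ δ
      -- If the maximum is `x`, this is the hypothesis; if it is `s`, then `s ^ k ≤ s` because
      -- `s ≤ 1#`, and `s * a ≤ δ` finishes.
      ag^k≤δ with ⊔-sel x s
      ... | inj₁ e = ≤-trans (≤-reflexive (*-congˡ (^-congˡ k e))) ax^k≤δ
      ... | inj₂ e = begin
        a * g ^ k ≈⟨ *-congˡ (^-congˡ k e) ⟩
        a * s ^ k ≤⟨ *-monoʳ-≤ a≥0 (x≤1⇒x^k≤x k (proj₁ s>0) s≤1) ⟩
        a * s     ≈⟨ *-comm a s ⟩
        s * a     ≤⟨ sa≤δ ⟩
        δ         ∎

  -- Norms, lower limits, limits and partial sums.

  ‖‖-nonneg : ∀ {k} (x : Vec ℝ k) → 0# ≤ ‖ x ‖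
  ‖‖-nonneg []      = ≤-refl
  ‖‖-nonneg (x ∷ y) = ≤-trans (‖‖-nonneg y) (x≤y⊔x ∣ x ∣ ‖ y ‖)

  ⟨⟩-nonneg : ∀ {k} (y : Vec ℝ k) → 0# ≤ ⟨ y ⟩
  ⟨⟩-nonneg y = ‖‖-nonneg (y ⊖ fromℤᵛ (proj₁ (minimiser y)))

  -- If `f q ≥ ε` held whenever `‖ q ‖ℤ` is at least `N`, then ε would bound the infimum of that
  -- tail from below, and the lower limit, a supremum of such infima, would be at least ε and so
  -- positive.
  0≮liminf⇒small : ∀ {n} (f : Vec ℤ n → ℝ) → ¬ ([ 0# ] <± liminf f) →
                   ∀ N {ε} → 0# < ε → ∃ λ q → N ℕ.≤ ‖ q ‖ℤ × f q < ε
  0≮liminf⇒small {n} f ¬pos N {ε} ε>0 = ¬∀¬⇒∃ λ none →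
    ¬pos (above (liminf f) (≤±.≤±-trans ≤-trans
      (proj₂ (proj₂ (infimum± Tail)) [ ε ] λ { _ (q , N≤ , ≡.refl) →
        ≤±.[ ≮⇒≥ (λ f<ε → none q (N≤ , f<ε)) ] })
      (proj₁ (proj₂ (supremum± _)) _ (N , ≡.refl))))
    where
    module ≤± = AddExtremaNonStrict _≤_
    module <± = AddExtremaStrict _<_

    Tail : Pred (ℝ ±) 0ℓ
    Tail w = ∃ λ q → N ℕ.≤ ‖ q ‖ℤ × w ≡ [ f q ]

    above : ∀ l → [ ε ] ≤± l → [ 0# ] <± l
    above ⊤±    _ = <±.[ 0# ]<⊤±
    above [ l ] p = <±.[ <-≤-trans ε>0 (≤±.[≤]-injective p) ]
    above ⊥±    ≤⁺.[ () ]

  -- If `l` exceeded `b`, every term would stay at distance at least `l - b` from `l`.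
  limit≤bound : ∀ {s l b} → s ⟶ l → (∀ k → s k ≤ b) → l ≤ b
  limit≤bound {s} {l} {b} lim bd with em {l ≤ b}
  ... | yes p = p
  ... | no ¬p with lim (l - b) (≰⇒< λ q → ¬p (≤-trans (x-z≤y⇒x≤y+z q)
                                   (≤-reflexive (+-identityˡ b))))
  ...   | N , h = ⊥-elim (<⇒≱ (h N ℕₚ.≤-refl) (begin
    l - b         ≤⟨ +-monoʳ-≤ l (-‿anti-≤ (bd N)) ⟩
    l - s N       ≈⟨ neg-minus (s N) l ⟨
    - (s N - l)   ≤⟨ -x≤∣x∣ _ ⟩
    ∣ s N - l ∣   ∎))

  partialSum-mono-≤ : ∀ {a b : Sequence⁺} K →
    (∀ q .{{_ : NonZero q}} → q ℕ.≤ K → a q ≤ b q) →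
    partialSum a K ≤ partialSum b K
  partialSum-mono-≤ zero    _ = ≤-refl
  partialSum-mono-≤ {a} {b} (suc K) h = +-mono-≤
    (partialSum-mono-≤ {a} {b} K (λ q q≤K → h q (ℕₚ.m≤n⇒m≤1+n q≤K)))
    (h (suc K) ℕₚ.≤-refl)

  partialSum-+ : ∀ (a b : Sequence⁺) K →
    partialSum (λ q → a q + b q) K ≈ partialSum a K + partialSum b K
  partialSum-+ a b zero    = sym (+-identityˡ 0#)
  partialSum-+ a b (suc K) = trans (+-congʳ (partialSum-+ a b K))
    (interchange _ _ _ _)
    where open CommutativeSemigroupProperties +-commutativeSemigroup using (interchange)

  term≤partialSum : ∀ {a : Sequence⁺} → (∀ q .{{_ : NonZero q}} → 0# ≤ a q) →
                    ∀ q .{{_ : NonZero q}} → a q ≤ partialSum a q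
  term≤partialSum {a} a≥0 (suc q) = begin
    a (suc q)                  ≤⟨ x≤x+y (partialSum-mono {a} a≥0 {0} {q} (ℕₚ.≤⇒≤′ ℕ.z≤n)) ⟩
    a (suc q) + partialSum a q ≈⟨ +-comm _ _ ⟩
    partialSum a q + a (suc q) ∎

-- Finiteness of the set of integer vectors of bounded norm.

boundedVectors : ∀ n k → ∃ λ (xs : List (Vec ℤ n)) →
                 -- The fold is `‖ q ‖ℤ` written out, as no real field is fixed here.
                 ∀ q → Vec.foldr′ ℕ._⊔_ 0 (Vec.map ℤ.∣_∣ q) ℕ.≤ k → q ∈ xs
boundedVectors zero    k = List.[ [] ] , λ { [] _ → here ≡.refl }
boundedVectors (suc n) k with boundedVectors n k
... | xs , h = List.cartesianProductWith _∷_ entries xs , λ { (x ∷ q) p →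
    ∈-cartesianProductWith⁺ _∷_ (∈-entries x (ℕₚ.m⊔n≤o⇒m≤o ℤ.∣ x ∣ _ p))
                            (h q (ℕₚ.m⊔n≤o⇒n≤o ℤ.∣ x ∣ _ p)) }
  where
  entries : List ℤ
  -- `-[1+ i ]` is -(i + 1), so the negative entries -1, ..., -k come from `i < k`, while 0, ..., k
  -- come from `i < suc k`.
  entries = List.map +_ (upTo (suc k)) List.++ List.map -[1+_] (upTo k)

  ∈-entries : ∀ x → ℤ.∣ x ∣ ℕ.≤ k → x ∈ entries
  ∈-entries (+ i)    p = ∈-++⁺ˡ (∈-map⁺ +_ (∈-upTo⁺ (ℕ.s≤s p)))
  ∈-entries -[1+ i ] p = ∈-++⁺ʳ (List.map +_ (upTo (suc k)))
                                (∈-map⁺ -[1+_] (∈-upTo⁺ p))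

-- Partial sums of the series defining 𝒞, and the metric d.

module SequenceSpace (em : ExcludedMiddle 0ℓ) (ℝ-field : CompleteOrderedField)
                     (m n : ℕ) .{{_ : NonZero m}} .{{_ : NonZero n}} where

  open Real em ℝ-field
  open Lemmas
  open RealProperties em ℝ-field
  open Exp (CommutativeRing.commutativeSemiring commutativeRing) using (^-congˡ)
  open PosetReasoning poset

  weight : ℕ → ℝ
  weight q = fromℕ q ^ (n ∸ 1)

  weight-nonneg : ∀ q → 0# ≤ weight q
  weight-nonneg q = ^-nonneg (n ∸ 1) (fromℕ-nonneg q)

  fromℕ*weight : ∀ q → fromℕ q * weight q ≡ fromℕ q ^ n
  fromℕ*weight q = ≡.cong (fromℕ q ^_) (ℕₚ.suc-pred n)

  massTerm : Sequence⁺ → Sequence⁺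
  massTerm ψ q = weight q * ψ q ^ m

  massTerm-nonneg : ∀ {ψ : Sequence⁺} → (∀ q .{{_ : NonZero q}} → 0# ≤ ψ q) →
                    ∀ q .{{_ : NonZero q}} → 0# ≤ massTerm ψ q
  massTerm-nonneg ψ≥0 q = *-nonneg (weight-nonneg q) (^-nonneg m (ψ≥0 q))

  mass : Sequence⁺ → ℕ → ℝ
  mass ψ = partialSum (massTerm ψ)

  mass-mono : ∀ {ψ χ : Sequence⁺} K → (∀ q .{{_ : NonZero q}} → 0# ≤ ψ q) →
              (∀ q .{{_ : NonZero q}} → q ℕ.≤ K → ψ q ≤ χ q) → mass ψ K ≤ mass χ K
  mass-mono {ψ} {χ} K ψ≥0 ψ≤χ =
    partialSum-mono-≤ {massTerm ψ} {massTerm χ} K λ q q≤K →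
      *-monoʳ-≤ (weight-nonneg q) (^-monoˡ-≤ m (ψ≥0 q) (ψ≤χ q q≤K))

  d-term : 𝒞 m n → 𝒞 m n → Sequence⁺
  d-term φ χ q = weight q * ∣ 𝒞.ψ φ q ^ m - 𝒞.ψ χ q ^ m ∣

  -- All terms are nonnegative, so one term is at most the sum. Hence closeness in `d` controls the
  -- value at each single `q`.
  d-term≤d : ∀ φ χ q .{{_ : NonZero q}} → d-term φ χ q ≤ d φ χ
  d-term≤d φ χ q = ≤-trans (term≤partialSum {d-term φ χ} nonneg q)
    (partialSum≤limit {d-term φ χ} nonneg (proj₂ (difference-summable φ χ)) q)
    where
    nonneg : ∀ q .{{_ : NonZero q}} → 0# ≤ d-term φ χ q
    nonneg q = *-nonneg (weight-nonneg q) (0≤∣x∣ _)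

  -- When φ ≤ χ the absolute values in `d` open up as χ^m - φ^m, so partial sums of `d` are
  -- differences of masses; adding the mass of φ to both sides avoids subtracting series.
  d≤mass-increase : ∀ φ χ {b} →
    (∀ q .{{_ : NonZero q}} → 𝒞.ψ φ q ≤ 𝒞.ψ χ q) →
    (∀ K → mass (𝒞.ψ χ) K ≤ mass (𝒞.ψ φ) K + b) → d φ χ ≤ b
  d≤mass-increase φ χ {b} φ≤χ increase =
    limit≤bound (proj₂ (difference-summable φ χ)) λ K →
      +-cancelʳ-≤ (mass φ.ψ K) (begin
        partialSum (d-term φ χ) K + mass φ.ψ K
          ≈⟨ partialSum-+ (d-term φ χ) (massTerm φ.ψ) K ⟨
        partialSum (λ q → d-term φ χ q + massTerm φ.ψ q) K
          ≤⟨ partialSum-mono-≤ {λ q → d-term φ χ q + massTerm φ.ψ q}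
                               {massTerm χ.ψ} K (λ q _ → termwise q) ⟩
        mass χ.ψ K
          ≤⟨ increase K ⟩
        mass φ.ψ K + b
          ≈⟨ +-comm _ b ⟩
        b + mass φ.ψ K ∎)
    where
    module φ = 𝒞 φ
    module χ = 𝒞 χ

    termwise : ∀ q .{{_ : NonZero q}} → d-term φ χ q + massTerm φ.ψ q ≤ massTerm χ.ψ q
    termwise q = begin
      weight q * ∣ x - y ∣ + weight q * x
        ≤⟨ +-monoˡ-≤ _ (*-monoʳ-≤ (weight-nonneg q) (⊔-lub
             (+-mono-≤ x≤y (-‿anti-≤ x≤y))
             (≤-reflexive (neg-minus x y)))) ⟩
      weight q * (y - x) + weight q * x
        ≈⟨ distribˡ (weight q) (y - x) x ⟨
      weight q * ((y - x) + x)
        ≈⟨ *-congˡ (x-y+y≈x y x) ⟩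
      weight q * y ∎
      where
      x = φ.ψ q ^ m
      y = χ.ψ q ^ m

      x≤y : x ≤ y
      x≤y = ^-monoˡ-≤ m (φ.nonneg q) (φ≤χ q)

  -- At each `q` the maximum is one of the two values, so its `m`-th power is at most the sum of
  -- their powers.
  mass-join : ∀ (φ χ : Sequence⁺) → (∀ q .{{_ : NonZero q}} → 0# ≤ φ q) →
              (∀ q .{{_ : NonZero q}} → 0# ≤ χ q) →
              ∀ K → mass (λ q → φ q ⊔ χ q) K ≤ mass φ K + mass χ K
  mass-join φ χ φ≥0 χ≥0 K = begin
    mass (λ q → φ q ⊔ χ q) K
      ≤⟨ partialSum-mono-≤ {massTerm (λ q → φ q ⊔ χ q)}
                           {λ q → massTerm φ q + massTerm χ q} K (λ q _ → begin
           weight q * (φ q ⊔ χ q) ^ m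
             ≤⟨ *-monoʳ-≤ (weight-nonneg q) (⊔-^-≤ m (φ≥0 q) (χ≥0 q)) ⟩
           weight q * (φ q ^ m + χ q ^ m)
             ≈⟨ distribˡ _ _ _ ⟩
           weight q * φ q ^ m + weight q * χ q ^ m ∎) ⟩
    partialSum (λ q → massTerm φ q + massTerm χ q) K
      ≈⟨ partialSum-+ (massTerm φ) (massTerm χ) K ⟩
    mass φ K + mass χ K ∎

  mass≤limit : ∀ (φ : 𝒞 m n) K → mass (𝒞.ψ φ) K ≤ proj₁ (𝒞.summable φ)
  mass≤limit φ = partialSum≤limit {massTerm (𝒞.ψ φ)}
    (massTerm-nonneg {𝒞.ψ φ} (𝒞.nonneg φ)) (proj₂ (𝒞.summable φ))

  _∨_ : 𝒞 m n → 𝒞 m n → 𝒞 m n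
  φ ∨ χ = record
    { ψ          = ψ
    ; nonneg     = ψ≥0
    ; decreasing = λ p q p≤q → ⊔-mono-≤ (φ.decreasing p q p≤q) (χ.decreasing p q p≤q)
    ; summable   = bounded⇒summable {massTerm ψ} (massTerm-nonneg {ψ} ψ≥0) λ K →
        ≤-trans (mass-join φ.ψ χ.ψ φ.nonneg χ.nonneg K)
                (+-mono-≤ (mass≤limit φ K) (mass≤limit χ K))
    }
    where
    module φ = 𝒞 φ
    module χ = 𝒞 χ

    ψ : Sequence⁺
    ψ q = φ.ψ q ⊔ χ.ψ q

    ψ≥0 : ∀ q .{{_ : NonZero q}} → 0# ≤ ψ q
    ψ≥0 q = ≤-trans (φ.nonneg q) (x≤x⊔y _ _)

  -- Step functions θ·1_[1,N] and their mass.

  indicator : ℕ → ℝ → Sequence⁺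
  indicator N θ q with q ℕ.≤? N
  ... | yes _ = θ
  ... | no  _ = 0#

  indicator-≤ : ∀ {N θ} q .{{_ : NonZero q}} → q ℕ.≤ N → indicator N θ q ≡ θ
  indicator-≤ {N} q q≤N with q ℕ.≤? N
  ... | yes _   = ≡.refl
  ... | no  q≰N = ⊥-elim (q≰N q≤N)

  indicator-> : ∀ {N θ} q .{{_ : NonZero q}} → N ℕ.< q → indicator N θ q ≡ 0#
  indicator-> {N} q N<q with q ℕ.≤? N
  ... | yes q≤N = ⊥-elim (ℕₚ.<⇒≱ N<q q≤N)
  ... | no  _   = ≡.refl

  indicator-nonneg : ∀ N {θ} → 0# ≤ θ → ∀ q .{{_ : NonZero q}} → 0# ≤ indicator N θ q
  indicator-nonneg N θ≥0 q with q ℕ.≤? N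
  ... | yes _ = θ≥0
  ... | no  _ = ≤-refl

  indicator≤ : ∀ N {θ} → 0# ≤ θ → ∀ q .{{_ : NonZero q}} → indicator N θ q ≤ θ
  indicator≤ N θ≥0 q with q ℕ.≤? N
  ... | yes _ = ≤-refl
  ... | no  _ = θ≥0

  indicator-decreasing : ∀ N {θ} → 0# ≤ θ →
    ∀ p q .{{_ : NonZero p}} .{{_ : NonZero q}} →
    p ℕ.≤ q → indicator N θ q ≤ indicator N θ p
  indicator-decreasing N θ≥0 p q p≤q with q ℕ.≤? N
  ... | yes q≤N = ≤-reflexive (reflexive (≡.sym (indicator-≤ p (ℕₚ.≤-trans p≤q q≤N))))
  ... | no  _   = indicator-nonneg N θ≥0 p

  -- Each of the first `N` terms is at most N^(n-1)·θ^m and all later ones vanish, so the total is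
  -- at most N·N^(n-1)·θ^m.
  mass-indicator : ∀ N {θ} → 0# ≤ θ → ∀ K →
                   mass (indicator N θ) K ≤ fromℕ N ^ n * θ ^ m
  mass-indicator N {θ} θ≥0 K = ≤-trans (every K) (≤-reflexive
    (trans (sym (*-assoc _ _ _)) (*-congʳ (reflexive (fromℕ*weight N)))))
    where
    c = weight N * θ ^ m

    c≥0 : 0# ≤ c
    c≥0 = *-nonneg (weight-nonneg N) (^-nonneg m θ≥0)

    initial : ∀ K → K ℕ.≤ N → mass (indicator N θ) K ≤ fromℕ K * c
    initial zero    _   = ≤-reflexive (sym (zeroˡ c))
    initial (suc K) K<N = begin
      mass (indicator N θ) K + massTerm (indicator N θ) (suc K)
        ≤⟨ +-mono-≤ (initial K (ℕₚ.<⇒≤ K<N)) (≤-trans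
             (*-monoʳ-≤ (weight-nonneg (suc K)) (^-monoˡ-≤ m
               (indicator-nonneg N θ≥0 (suc K)) (indicator≤ N θ≥0 (suc K))))
             (*-monoˡ-≤ (^-nonneg m θ≥0) (^-monoˡ-≤ (n ∸ 1)
               (fromℕ-nonneg (suc K)) (fromℕ-mono K<N)))) ⟩
      fromℕ K * c + c
        ≈⟨ +-comm _ c ⟩
      c + fromℕ K * c
        ≈⟨ +-congʳ (*-identityˡ c) ⟨
      1# * c + fromℕ K * c
        ≈⟨ distribʳ c 1# (fromℕ K) ⟨
      fromℕ (suc K) * c ∎

    every : ∀ K → mass (indicator N θ) K ≤ fromℕ N * c
    every zero    = *-nonneg (fromℕ-nonneg N) c≥0
    every (suc K) with ℕₚ.≤-<-connex (suc K) N
    ... | inj₁ K<N = ≤-trans (initial (suc K) K<N) (*-monoˡ-≤ c≥0 (fromℕ-mono K<N))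
    ... | inj₂ N≤K = begin
      mass (indicator N θ) K + massTerm (indicator N θ) (suc K)
        -- Beyond `N` the term contains the power 0^m, which is at most 0 because `m` is positive.
        ≤⟨ +-mono-≤ (every K) (*-monoʳ-≤ (weight-nonneg (suc K)) (≤-trans
             (≤-reflexive (^-congˡ m (reflexive (indicator-> (suc K) N≤K))))
             (x≤1⇒x^k≤x m ≤-refl 0≤1))) ⟩
      fromℕ N * c + weight (suc K) * 0#
        ≈⟨ trans (+-congˡ (zeroʳ _)) (+-identityʳ _) ⟩
      fromℕ N * c ∎

  stepFunction : ∀ N {θ} → 0# ≤ θ → 𝒞 m n
  stepFunction N {θ} θ≥0 = record
    { ψ          = indicator N θ
    ; nonneg     = indicator-nonneg N θ≥0
    ; decreasing = indicator-decreasing N θ≥0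
    ; summable   = bounded⇒summable {massTerm (indicator N θ)}
        (massTerm-nonneg {indicator N θ} (indicator-nonneg N θ≥0)) (mass-indicator N θ≥0)
    }

-- Solvability of f(q) < ψ(‖q‖) beyond a given norm.

module Approximation (em : ExcludedMiddle 0ℓ) (ℝ-field : CompleteOrderedField)
                     (m n : ℕ) .{{_ : NonZero m}} .{{_ : NonZero n}} where

  open Real em ℝ-field
  open Lemmas
  open RealProperties em ℝ-field
  open SequenceSpace em ℝ-field m n
  open PosetReasoning poset
  open Topology (d {m} {n})

  -- `f` stands for ⟨Aq - γ⟩, and `small-f` is the form in which the failure of badness enters.
  module _ (f : Vec ℤ n → ℝ) (f≥0 : ∀ q → 0# ≤ f q)
           (small-f : ∀ N {ε} → 0# < ε →
                      ∃ λ q → N ℕ.≤ ‖ q ‖ℤ × fromℕ ‖ q ‖ℤ ^ n * f q ^ m < ε)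
           where

    Solution : 𝒞 m n → Pred (Vec ℤ n) 0ℓ
    Solution φ q = Σ (NonZero ‖ q ‖ℤ) λ nz → f q < 𝒞.ψ φ ‖ q ‖ℤ {{nz}}

    InfinitelySolvable : Pred (𝒞 m n) 0ℓ
    InfinitelySolvable φ = Infinite (Solution φ)

    SolvableBeyond : ℕ → Pred (𝒞 m n) 0ℓ
    SolvableBeyond k φ = ∃ λ q → k ℕ.≤ ‖ q ‖ℤ × Solution φ q

    -- Otherwise all solutions would lie in the finite list of vectors of norm at most `k`.
    infinite⇒beyond : ∀ φ → InfinitelySolvable φ → ∀ k → SolvableBeyond k φ
    infinite⇒beyond φ inf k = ¬∀¬⇒∃ λ none →
      let xs , complete = boundedVectors n k
      in inf (xs , λ {q} sol → complete q (ℕₚ.<⇒≤ (ℕₚ.≰⇒> λ k≤ → none q (k≤ , sol))))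

    beyond⇒infinite : ∀ φ → (∀ k → SolvableBeyond k φ) → InfinitelySolvable φ
    beyond⇒infinite φ beyond (xs , covers) =
      let q , large , sol = beyond (suc M)
      in ℕₚ.<⇒≱ large (ListAll.lookup (xs≤max 0 norms) (∈-map⁺ ‖_‖ℤ (covers sol)))
      where
      open Extrema ℕₚ.≤-totalOrder using (max; xs≤max)
      norms = List.map ‖_‖ℤ xs
      M = max 0 norms

    -- The same `q` stays a solution: if χ(‖q‖) dropped to `f q` or below, the term of `d φ χ` at
    -- ‖q‖ alone would reach `ε`.
    solvableBeyond-open : ∀ k → Open (SolvableBeyond k)
    solvableBeyond-open k φ (q , k≤ , nz , f<φ) = ε , ε>0 , λ χ near →
      q , k≤ , nz , ≰⇒< λ χ≤f → <⇒≱ near (begin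
        ε
          ≤⟨ *-monoʳ-≤ (weight-nonneg N) (≤-trans
               (+-monoʳ-≤ _ (-‿anti-≤ (^-monoˡ-≤ m (𝒞.nonneg χ N) χ≤f)))
               (x≤∣x∣ _)) ⟩
        d-term φ χ N
          ≤⟨ d-term≤d φ χ N ⟩
        d φ χ ∎)
      where
      instance _ = nz
      N = ‖ q ‖ℤ
      ε = weight N * (𝒞.ψ φ N ^ m - f q ^ m)

      ε>0 : 0# < ε
      ε>0 = *-pos (^-pos (n ∸ 1) (<-≤-trans 0<1 (1≤fromℕ N)))
        (≰⇒< λ p → <⇒≱ (^-monoˡ-< m (f≥0 q) f<φ)
          (≤-trans (x-z≤y⇒x≤y+z p) (≤-reflexive (+-identityˡ _))))

    -- Step functions of small mass that create a solution of large norm.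

    record Spike (k : ℕ) (ε τ : ℝ) : Set where
      field
        q      : Vec ℤ n
        height : ℝ
        beyond : k ℕ.< ‖ q ‖ℤ
        above  : f q < height
        capped : height ≤ τ
        light  : fromℕ ‖ q ‖ℤ ^ n * height ^ m ≤ ε

      height>0 : 0# < height
      height>0 = ≤-<-trans (f≥0 q) above

    abstract
      -- Let η be the minimum of ε and τ^m. Raising the height strictly above `f q` costs a factor
      -- 2^m in `overshoot`, so `small-f` is applied with δ such that δ·2^m ≤ η.
      spike : ∀ k {ε τ} → 0# < ε → 0# < τ → Spike k ε τ
      spike k {ε} {τ} ε>0 τ>0 =
        let η , η>0 , η≤ε , η≤τ^m  = positive-lower-bound ε>0 (^-pos m τ>0)
            δ , δ>0 , _ , δ2^m≤η   = small-multiplier (^-nonneg m 0≤2) η>0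
            q , k<‖q‖ , weighted<δ = small-f (suc k) δ>0
            θ , f<θ , weighted≤    = overshoot m (f≥0 q)
              (^-nonneg n (fromℕ-nonneg ‖ q ‖ℤ)) δ>0 (proj₁ weighted<δ)
        in fromHeight q k<‖q‖ f<θ η≤ε η≤τ^m (≤-trans weighted≤ δ2^m≤η)
        where
        fromHeight : ∀ q → k ℕ.< ‖ q ‖ℤ → ∀ {θ η} → f q < θ → η ≤ ε → η ≤ τ ^ m →
                     fromℕ ‖ q ‖ℤ ^ n * θ ^ m ≤ η → Spike k ε τ
        fromHeight q k<‖q‖ {θ} {η} f<θ η≤ε η≤τ^m weighted≤η = record
          { q      = q
          ; height = θ
          ; beyond = k<‖q‖
          ; above  = f<θ
          -- As ‖q‖ ≥ 1, the weight ‖q‖^n is at least 1, so θ^m ≤ η ≤ τ^m, and strict monotonicity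
          -- of the power excludes τ < θ.
          ; capped = ≮⇒≥ λ τ<θ → <⇒≱ (^-monoˡ-< m (proj₁ τ>0) τ<θ) (begin
              θ ^ m                      ≈⟨ *-identityˡ _ ⟨
              1# * θ ^ m                 ≤⟨ *-monoˡ-≤ (^-nonneg m θ≥0) (1≤x⇒1≤x^k n
                                              (≤-trans (1≤fromℕ 1) (fromℕ-mono N≥1))) ⟩
              fromℕ ‖ q ‖ℤ ^ n * θ ^ m   ≤⟨ weighted≤η ⟩
              η                          ≤⟨ η≤τ^m ⟩
              τ ^ m                      ∎)
          ; light  = ≤-trans weighted≤η η≤ε
          }
          where
          N≥1 : 1 ℕ.≤ ‖ q ‖ℤ
          N≥1 = ℕₚ.≤-trans (ℕ.s≤s ℕ.z≤n) k<‖q‖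

          θ≥0 : 0# ≤ θ
          θ≥0 = ≤-trans (f≥0 q) (proj₁ f<θ)

    -- The limit of successive joins, kept inside every `V k`.

    module Limit
      -- `P` is an invariant of the finite stages that the limit may lose; each `V k` is an open
      -- condition that the limit must satisfy.
      (P : Pred (𝒞 m n) 0ℓ) (V : ℕ → Pred (𝒞 m n) 0ℓ)
      (P-step : ∀ φ N {θ} (θ≥0 : 0# ≤ θ) → P φ → P (φ ∨ stepFunction N θ≥0))
      (P⊆V : ∀ k → P ⊆ V k) (V-open : ∀ k → Open (V k))
      (φ₀ : 𝒞 m n) (Pφ₀ : P φ₀) {ε : ℝ} (ε>0 : 0# < ε)
      where

      -- One `budget` pays for the next spike and a second one becomes the `allowance` of the next
      -- stage. All later joins together thus move φ by at most `budget + budget`, a distance within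
      -- which `safe` guarantees `V k`.
      record Stage (k : ℕ) (allowance : ℝ) : Set where
        field
          φ        : 𝒞 m n
          P-φ      : P φ
          cap      : ℝ
          cap>0    : 0# < cap
          budget   : ℝ
          budget>0 : 0# < budget
          afford   : budget + budget ≤ allowance
          safe     : ∀ χ → d φ χ ≤ budget + budget → V k χ

        next : Spike k budget cap
        next = spike k budget>0 cap>0

        open Spike next public

      stage-at : ∀ k {a τ} → 0# < a → 0# < τ → (φ : 𝒞 m n) → P φ → Stage k a
      stage-at k {a} {τ} a>0 τ>0 φ Pφ =
        -- The chain 2h ≤ t ≤ r′ < 2r′ ≤ r turns the non-strict bound in `safe` into the strict one
        -- required by the ball of radius `r`.
        let r , r>0 , ball = V-open k φ (P⊆V k Pφ)
            r′ , r′>0 , 2r′≤r = half r>0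
            t , t>0 , t≤a , t≤r′ = positive-lower-bound a>0 r′>0
            h , h>0 , 2h≤t = half t>0
        in record
          { φ        = φ
          ; P-φ      = Pφ
          ; cap      = τ
          ; cap>0    = τ>0
          ; budget   = h
          ; budget>0 = h>0
          ; afford   = ≤-trans 2h≤t t≤a
          ; safe     = λ χ near → ball χ (≤-<-trans near
              (≤-<-trans (≤-trans 2h≤t t≤r′) (<-≤-trans (x<x+x r′>0) 2r′≤r)))
          }

      -- The height just used becomes the next cap, so that the heights decrease.
      after : ∀ {k a} (s : Stage k a) → Stage (suc k) (Stage.budget s)
      after {k} s = stage-at (suc k) {budget} {height} budget>0 height>0 _
        (P-step φ ‖ q ‖ℤ {height} (proj₁ height>0) P-φ)
        where open Stage s

      -- Starting with half of ε leaves the limit at distance strictly below ε; any positive first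
      -- cap would do.
      initial : Stage 0 (proj₁ (half ε>0))
      initial = stage-at zero (proj₁ (proj₂ (half ε>0))) 0<1 φ₀ Pφ₀

      abstract
        stages : ∀ k → ∃ (Stage k)
        stages zero    = _ , initial
        stages (suc k) = _ , after (proj₂ (stages k))

      private
        module S k = Stage (proj₂ (stages k))

      φ : ℕ → Sequence⁺
      φ k = 𝒞.ψ (S.φ k)

      φ-nonneg : ∀ k q .{{_ : NonZero q}} → 0# ≤ φ k q
      φ-nonneg k = 𝒞.nonneg (S.φ k)

      spikeSequence : ℕ → Sequence⁺
      spikeSequence k = indicator ‖ S.q k ‖ℤ (S.height k)

      abstract
        S-zero : S.φ 0 ≡ φ₀
        S-zero = ≡.refl

        allowance-zero : proj₁ (stages 0) ≡ proj₁ (half ε>0)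
        allowance-zero = ≡.refl

        allowance-suc : ∀ k → proj₁ (stages (suc k)) ≡ S.budget k
        allowance-suc k = ≡.refl

        cap-suc : ∀ k → S.cap (suc k) ≡ S.height k
        cap-suc k = ≡.refl

        φ-suc : ∀ k q .{{_ : NonZero q}} → φ (suc k) q ≡ φ k q ⊔ spikeSequence k q
        φ-suc k q = ≡.refl

      reserve : ℕ → ℝ
      reserve k = S.budget k + S.budget k

      φ-suc-≤ : ∀ k q .{{_ : NonZero q}} → φ (suc k) q ≤ φ k q ⊔ spikeSequence k q
      φ-suc-≤ k q = ≤-reflexive (reflexive (φ-suc k q))

      φ-suc-≥ : ∀ k q .{{_ : NonZero q}} → φ k q ⊔ spikeSequence k q ≤ φ (suc k) q
      φ-suc-≥ k q = ≤-reflexive (reflexive (≡.sym (φ-suc k q)))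

      φ-mono : ∀ {j k} → j ℕ.≤′ k → ∀ q .{{_ : NonZero q}} → φ j q ≤ φ k q
      φ-mono (ℕ.≤′-reflexive ≡.refl) q = ≤-refl
      φ-mono (ℕ.≤′-step {k} p)       q = ≤-trans (φ-mono p q)
        (≤-trans (x≤x⊔y (φ k q) (spikeSequence k q)) (φ-suc-≥ k q))

      height≤φ : ∀ k q .{{_ : NonZero q}} → q ℕ.≤ ‖ S.q k ‖ℤ → S.height k ≤ φ (suc k) q
      height≤φ k q q≤N = ≤-trans (≤-reflexive (reflexive (≡.sym
          (indicator-≤ {‖ S.q k ‖ℤ} {S.height k} q q≤N))))
        (≤-trans (x≤y⊔x (φ k q) (spikeSequence k q)) (φ-suc-≥ k q))

      -- For positive `k`, `cap k` is the height of the spike joined last, and that spike extends at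
      -- least up to `k`. At stage 0 there is no positive `q` to consider.
      cap≤φ : ∀ k q .{{_ : NonZero q}} → q ℕ.≤ k → S.cap k ≤ φ k q
      cap≤φ zero    (suc _) ()
      cap≤φ (suc k) q       q≤1+k = ≤-trans (≤-reflexive (reflexive (cap-suc k)))
        (height≤φ k q (ℕₚ.≤-trans q≤1+k (S.beyond k)))

      -- As the heights decrease, φ k q no longer changes once k ≥ q.
      φ-stable : ∀ {q k} .{{_ : NonZero q}} → q ℕ.≤′ k → φ k q ≤ φ q q
      φ-stable (ℕ.≤′-reflexive ≡.refl) = ≤-refl
      φ-stable {q} (ℕ.≤′-step {k} p)   = ≤-trans (φ-suc-≤ k q) (≤-trans
        (⊔-lub ≤-refl (≤-trans (indicator≤ ‖ S.q k ‖ℤ {S.height k} (proj₁ (S.height>0 k)) q)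
          (≤-trans (S.capped k) (cap≤φ k q (ℕₚ.≤′⇒≤ p)))))
        (φ-stable p))

      -- By `φ-stable` the diagonal value is the eventual value of `φ k q`, hence the pointwise
      -- limit.
      ψ∞ : Sequence⁺
      ψ∞ q = φ q q

      φ≤ψ∞ : ∀ k q .{{_ : NonZero q}} → φ k q ≤ ψ∞ q
      φ≤ψ∞ k q = [ (λ k≤q → φ-mono {k} {q} (ℕₚ.≤⇒≤′ k≤q) q)
                 , (λ q≤k → φ-stable {q} {k} (ℕₚ.≤⇒≤′ q≤k)) ]′ (ℕₚ.≤-total k q)

      -- Mass plus reserve never grows: the spike uses up at most one budget, and the new reserve
      -- fits into the other.
      mass-step : ∀ k K → mass (φ (suc k)) K + reserve (suc k) ≤ mass (φ k) K + reserve k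
      mass-step k K = begin
        mass (φ (suc k)) K + reserve (suc k)
          ≤⟨ +-mono-≤ (mass-mono {φ (suc k)} {λ q → φ k q ⊔ spikeSequence k q} K
                        (φ-nonneg (suc k)) (λ q _ → φ-suc-≤ k q))
                      (≤-trans (S.afford (suc k))
                        (≤-reflexive (reflexive (allowance-suc k)))) ⟩
        mass (λ q → φ k q ⊔ spikeSequence k q) K + S.budget k
          ≤⟨ +-monoˡ-≤ _ (mass-join (φ k) (spikeSequence k) (φ-nonneg k)
                           (indicator-nonneg ‖ S.q k ‖ℤ θ≥0) K) ⟩
        (mass (φ k) K + mass (spikeSequence k) K) + S.budget k
          ≤⟨ +-monoˡ-≤ _ (+-monoʳ-≤ _
               (≤-trans (mass-indicator ‖ S.q k ‖ℤ θ≥0 K) (S.light k))) ⟩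
        (mass (φ k) K + S.budget k) + S.budget k
          ≈⟨ +-assoc _ _ _ ⟩
        mass (φ k) K + reserve k ∎
        where
        θ≥0 : 0# ≤ S.height k
        θ≥0 = proj₁ (S.height>0 k)

      mass-steps : ∀ {j k} → j ℕ.≤′ k → ∀ K →
                   mass (φ k) K + reserve k ≤ mass (φ j) K + reserve j
      mass-steps (ℕ.≤′-reflexive ≡.refl) K = ≤-refl
      mass-steps (ℕ.≤′-step {k} p)       K = ≤-trans (mass-step k K) (mass-steps p K)

      -- The sum up to `K` sees only `q ≤ K`, where the limit is at most the finite stage `j ℕ.⊔ K`;
      -- the bound for that stage telescopes.
      mass-ψ∞≤ : ∀ j K → mass ψ∞ K ≤ mass (φ j) K + reserve j
      mass-ψ∞≤ j K = begin
        mass ψ∞ K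
          ≤⟨ mass-mono {ψ∞} {φ k} K (λ q → φ-nonneg q q) (λ q q≤K →
               φ-mono (ℕₚ.≤⇒≤′ (ℕₚ.m≤n⇒m≤o⊔n j q≤K)) q) ⟩
        mass (φ k) K
          ≤⟨ x≤x+y (≤-trans (proj₁ (S.budget>0 k)) (x≤x+y (proj₁ (S.budget>0 k)))) ⟩
        mass (φ k) K + reserve k
          ≤⟨ mass-steps (ℕₚ.≤⇒≤′ (ℕₚ.m≤m⊔n j K)) K ⟩
        mass (φ j) K + reserve j ∎
        where k = j ℕ.⊔ K

      φ∞ : 𝒞 m n
      φ∞ = record
        { ψ          = ψ∞
        ; nonneg     = λ q → φ-nonneg q q
        -- For p ≤ q: φ q q ≤ φ q p since stage `q` is decreasing, and φ q p ≤ φ p p by stability.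
        ; decreasing = λ p q p≤q → ≤-trans (𝒞.decreasing (S.φ q) p q p≤q)
                                           (φ-stable (ℕₚ.≤⇒≤′ p≤q))
        ; summable   = bounded⇒summable {massTerm ψ∞}
            (massTerm-nonneg {ψ∞} (λ q → φ-nonneg q q)) λ K →
            ≤-trans (mass-ψ∞≤ 0 K) (+-monoˡ-≤ (reserve 0) (mass≤limit (S.φ 0) K))
        }

      d-φ∞≤ : ∀ k → d (S.φ k) φ∞ ≤ reserve k
      d-φ∞≤ k = d≤mass-increase (S.φ k) φ∞ (φ≤ψ∞ k) (mass-ψ∞≤ k)

      φ∞∈V : ∀ k → V k φ∞
      φ∞∈V k = S.safe k φ∞ (d-φ∞≤ k)

      φ∞-near : d φ₀ φ∞ < ε
      φ∞-near = ≡.subst (λ φ → d φ φ∞ < ε) S-zero (≤-<-trans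
        (≤-trans (d-φ∞≤ 0)
          (≤-trans (S.afford 0) (≤-reflexive (reflexive allowance-zero))))
        (<-≤-trans (x<x+x (proj₁ (proj₂ (half ε>0)))) (proj₂ (proj₂ (half ε>0)))))

      -- The spike of stage `k` makes `S.q k`, of norm above `k`, a solution, and later joins only
      -- raise the function.
      φ∞-infinitelySolvable : InfinitelySolvable φ∞
      φ∞-infinitelySolvable = beyond⇒infinite φ∞ λ k →
        let instance nz = ℕ.>-nonZero (ℕₚ.≤-<-trans ℕ.z≤n (S.beyond k)) in
        S.q k , ℕₚ.<⇒≤ (S.beyond k) , nz , <-≤-trans (S.above k)
          (≤-trans (height≤φ k ‖ S.q k ‖ℤ ℕₚ.≤-refl) (φ≤ψ∞ (suc k) ‖ S.q k ‖ℤ))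

    -- The Gδ property, density, and failure of the Fσ property.

    infinitelySolvable-Gδ : IsGδ InfinitelySolvable
    infinitelySolvable-Gδ =
      SolvableBeyond , solvableBeyond-open ,
      (λ {φ} → infinite⇒beyond φ) , (λ {φ} → beyond⇒infinite φ)

    infinitelySolvable-dense : Dense InfinitelySolvable
    infinitelySolvable-dense φ₀ ε ε>0 = φ∞ , φ∞-infinitelySolvable , φ∞-near
      where
      -- Density imposes no condition on stages or limit, so every radius is admissible and 1 is
      -- taken.
      open Limit (λ _ → ⊤) (λ _ _ → ⊤) _ _ (λ _ _ _ → 1# , 0<1 , _) φ₀ _ ε>0

    -- The step function vanishes beyond `N`, so solutions of norm above `N` are already solutions
    -- for φ.
    ∨-step-infinitelySolvable : ∀ φ N {θ} (θ≥0 : 0# ≤ θ) →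
      InfinitelySolvable (φ ∨ stepFunction N θ≥0) → InfinitelySolvable φ
    ∨-step-infinitelySolvable φ N θ≥0 inf = beyond⇒infinite φ λ k →
      let q , large , nz , sol = infinite⇒beyond (φ ∨ stepFunction N θ≥0) inf (k ℕ.⊔ suc N)
          instance _ = nz
      in q , ℕₚ.m⊔n≤o⇒m≤o k (suc N) large , nz , <-≤-trans sol
           (⊔-lub ≤-refl (≤-trans
             (≤-reflexive (reflexive (indicator-> ‖ q ‖ℤ (ℕₚ.m⊔n≤o⇒n≤o k (suc N) large))))
             (𝒞.nonneg φ ‖ q ‖ℤ)))

    zeroFunction : 𝒞 m n
    zeroFunction = stepFunction 0 ≤-refl

    zero-not-infinitelySolvable : ¬ InfinitelySolvable zeroFunction
    zero-not-infinitelySolvable inf =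
      let q , _ , nz , sol = infinite⇒beyond zeroFunction inf 0
      in <⇒≱ (≤-<-trans (f≥0 q) sol) (indicator≤ 0 ≤-refl ‖ q ‖ℤ {{nz}})

    infinitelySolvable-not-Fσ : ¬ IsFσ InfinitelySolvable
    infinitelySolvable-not-Fσ (F , F-closed , ⊆F , F⊆) =
      let k , Fk = ⊆F φ∞-infinitelySolvable in φ∞∈V k Fk
      where
      -- Every finite stage lies outside the union, hence outside each `F k`. `Closed` means that
      -- the complement is open, so `F-closed` supplies the balls around the stages.
      open Limit (∁ InfinitelySolvable) (λ k → ∁ (F k))
        (λ φ N θ≥0 ¬inf inf → ¬inf (∨-step-infinitelySolvable φ N θ≥0 inf))
        (λ k ¬inf Fk → ¬inf (F⊆ (k , Fk)))
        F-closed zeroFunction zero-not-infinitelySolvable 0<1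

-- Specialisation to f(q) = ⟨Aq - γ⟩ for a pair that is not bad.

theorem1p7 : (em : ExcludedMiddle 0ℓ) (ℝ-field : CompleteOrderedField) →
    let open Real em ℝ-field in
    (m n : ℕ) .{{_ : NonZero m}} .{{_ : NonZero n}} →
    (A : Matrix m n) (γ : Vec ℝ m) →
    All (All [0,1⟩) A → All [0,1⟩ γ → ¬ Bad m n (A , γ) →
    let open Topology (d {m} {n}) in
    (IsGδ 𝒞⟨ A , γ ⟩ × Dense 𝒞⟨ A , γ ⟩) × ¬ IsFσ 𝒞⟨ A , γ ⟩
theorem1p7 em ℝ-field m n A γ _ _ ¬bad =
  (infinitelySolvable-Gδ f f≥0 small-f , infinitelySolvable-dense f f≥0 small-f) ,
  infinitelySolvable-not-Fσ f f≥0 small-f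
  where
  open Real em ℝ-field
  open RealProperties em ℝ-field using (⟨⟩-nonneg; 0≮liminf⇒small)
  open Approximation em ℝ-field m n

  f : Vec ℤ n → ℝ
  f q = ⟨ (A ·ᵛ fromℤᵛ q) ⊖ γ ⟩

  f≥0 : ∀ q → 0# ≤ f q
  f≥0 q = ⟨⟩-nonneg ((A ·ᵛ fromℤᵛ q) ⊖ γ)

  small-f : ∀ N {ε} → 0# < ε → ∃ λ q → N ℕ.≤ ‖ q ‖ℤ × fromℕ ‖ q ‖ℤ ^ n * f q ^ m < ε
  small-f = 0≮liminf⇒small (λ q → fromℕ ‖ q ‖ℤ ^ n * f q ^ m) ¬bad
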